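{- Let $n\ge 1$, $N=2n+1$, and $c=(1\;2\;\ldots\;N)\in\mathfrak{A}_N$. For every integer $q\ge 1$, the number of multichains $x_1\le_{\mathbf 3}x_2\le_{\mathbf 3}\cdots\le_{\mathbf 3}x_{q-1}$ of elements of the interval $[e,c]_{\mathbf 3}$ (i.e. the value $\mathcal Z(q)$ of the zeta polynomial of $[e,c]_{\mathbf 3}$) equals $$\mathcal{Z}(q)=\frac{q}{q(2n+1)-n}\binom{q(2n+1)-n}{n}.$$
   Context: $\mathfrak{S}_N$ is the symmetric group on $[N]=\{1,\dots,N\}$, $\mathfrak{A}_N$ the alternating group, $e$ the identity; $(1\;2\;\ldots\;N)$ denotes the cycle $1\mapsto2\mapsto\cdots\mapsto N\mapsto1$. For $x\in\mathfrak{A}_N$, $\ell_{\mathbf 3}(x)$ is the minimal number $k$ such that $x$ is a product of $k$ $3$-cycles. The partial order $\le_{\mathbf 3}$ on $\mathfrak{A}_N$ is defined by $x\le_{\mathbf 3}y$ iff $\ell_{\mathbf 3}(y)=\ell_{\mathbf 3}(x)+\ell_{\mathbf 3}(x^{ -1}y)$, and $[u,v]_{\mathbf 3}=\{w\in\mathfrak A_N: u\le_{\mathbf 3}w\le_{\mathbf 3}v\}$. The zeta polynomial $\mathcal Z(q)$ of a finite poset counts multichains (weakly increasing sequences) of length $q-1$. -}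

module Defs where

open import Data.Nat using (ℕ; zero; suc; _+_; _*_; _<_)
open import Data.Nat.DivMod using (_mod_)
open import Data.Fin using (Fin; toℕ; _≟_)
open import Data.Vec using (Vec; tabulate; lookup; []; _∷_)
open import Data.List using (List; foldr; length; map)
open import Data.List.Membership.Propositional using (_∈_)
open import Data.List.Relation.Unary.Unique.Propositional using (Unique)
open import Data.Product using (Σ; ∃; _×_; _,_)
open import Data.Unit using (⊤)
open import Data.Bool using (if_then_else_)
open import Relation.Nullary using (¬_; does)
open import Relation.Binary.PropositionalEquality using (_≡_; _≢_)
open import Function.Bundles using (_⇔_)

-- Permutations of [N] (0-indexed as Fin N) in one-line notation:
-- the vector whose i-th entry is the image of i.
Perm : ℕ → Set
Perm N = Vec (Fin N) N

ident : ∀ {N} → Perm N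
ident = tabulate (λ i → i)

_·_ : ∀ {N} → Perm N → Perm N → Perm N
x · y = tabulate (λ i → lookup x (lookup y i))

record Triple (N : ℕ) : Set where
  constructor triple
  field
    a b d : Fin N
    a≢b : a ≢ b
    b≢d : b ≢ d
    a≢d : a ≢ d

threeCycle : ∀ {N} → Triple N → Perm N
threeCycle {N} (triple a b d _ _ _) = tabulate f
  where
  f : Fin N → Fin N
  f i = if does (i ≟ a) then b else
        (if does (i ≟ b) then d else
        (if does (i ≟ d) then a else i))

IsProd3 : ∀ {N} → ℕ → Perm N → Set
IsProd3 {N} k x = Σ (List (Triple N)) λ L →
  length L ≡ k × foldr _·_ ident (map threeCycle L) ≡ x

-- ℓ₃ x ≡ k : k is the minimal number of 3-cycles whose product is x
-- (defined exactly on the alternating group)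
Len3 : ∀ {N} → Perm N → ℕ → Set
Len3 x k = IsProd3 k x × (∀ j → j < k → ¬ IsProd3 j x)

-- x ≤₃ y  iff  ℓ₃(y) = ℓ₃(x) + ℓ₃(x⁻¹ y); here z = x⁻¹ y is the unique
-- permutation with x · z ≡ y.
_≤₃_ : ∀ {N} → Perm N → Perm N → Set
x ≤₃ y = ∃ λ z → (x · z ≡ y) × ∃ λ a → ∃ λ b → ∃ λ c →
  Len3 x a × Len3 z b × Len3 y c × (c ≡ a + b)

longCycle : ∀ m → Perm (suc m)
longCycle m = tabulate (λ i → suc (toℕ i) mod suc m)

InInterval : ∀ {N} → Perm N → Perm N → Perm N → Set
InInterval u v w = (u ≤₃ w) × (w ≤₃ v)

AllIn : ∀ {N p} → Perm N → Perm N → Vec (Perm N) p → Set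
AllIn u v [] = ⊤
AllIn u v (x ∷ xs) = InInterval u v x × AllIn u v xs

Increasing : ∀ {N p} → Vec (Perm N) p → Set
Increasing [] = ⊤
Increasing (x ∷ []) = ⊤
Increasing (x ∷ y ∷ xs) = (x ≤₃ y) × Increasing (y ∷ xs)

IsMultichain : ∀ {N p} → Perm N → Perm N → Vec (Perm N) p → Set
IsMultichain u v xs = AllIn u v xs × Increasing xs

HasCount : {A : Set} → (A → Set) → ℕ → Set
HasCount {A} P k = Σ (List A) λ L →
  Unique L × (∀ a → (a ∈ L) ⇔ P a) × length L ≡ k

{-# OPTIONS --safe #-}
-- A multichain x₁ ≤₃ ⋯ ≤₃ x_{q-1} in [e, c]₃ is a factorization c = z₁ ⋯ z_q whose factors are
-- products of m₁, …, m_q 3-cycles with Σ mⱼ = n.  Placing zⱼ at label u on position j + u q of a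
-- line of q N positions turns a factorization into one permutation ζ of the positions (a cactus
-- read along its contour).  If ζ maps s ↦ s + q ↦ s + 2q and fixes everything in between, two
-- consecutive labels can be deleted from the factorization; conversely two labels can be inserted
-- at any position.  Always deleting the last such pair gives a canonical code: a sequence of
-- insertion positions.  After an insertion at s the positions still allowed are the 2q - 1 new ones
-- other than s + q together with the previously allowed ones after s, so the codes are counted by
-- the recursion T(n+1, r+1) = T(n, r + 2q - 1) + T(n+1, r) of the Raney numbers.
--
-- A removable pair exists by counting.  A product of m 3-cycles has no independent set (a set
-- disjoint from its image) of more than m points, hence moves at most 3m points.  Follow each label
-- u along z_q, …, z₁: every path makes at least one move, and there are at most 3n moves in all.
-- If no pair were removable, the labels u < 2n whose path makes exactly one move, in zⱼ, would be
-- independent for zⱼ, so there would be at most n of them; then 2 · 2n + 1 ≤ 3n + n.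
module Submission where

open import Defs
open import Data.Nat
open import Data.Nat.Properties
open import Data.Nat.Combinatorics using (_C_; nCk+nC[k+1]≡[n+1]C[k+1]; nC1≡n)
open import Data.Nat.DivMod using (_mod_; m≡m%n+[m/n]*n; m%n<n; [m+kn]%n≡m%n; m<n⇒m%n≡m; +-distrib-/-∣ʳ; m<n⇒m/n≡0; m*n/n≡m; m<n*o⇒m/o<n; n%n≡0)
open import Data.Nat.Divisibility using (n∣m*n)
open import Data.Nat.Tactic.RingSolver using (solve-∀)
open import Data.Bool using (if_then_else_)
open import Data.Fin as Fin using (Fin; toℕ; fromℕ<)
open import Data.Fin.Properties using (fromℕ<-toℕ; toℕ-fromℕ<; toℕ-injective; toℕ<n)
open import Data.List using (List; []; _∷_; _++_; map; filter; foldr; length; upTo; applyUpTo; downFrom; concatMap)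
open import Data.List.Properties using (length-++; length-map; length-applyUpTo; length-downFrom; filter-all; filter-reject; ∷-injectiveˡ; ∷-injectiveʳ)
open import Data.List.Membership.Propositional using (_∈_; _∉_; find; lose)
open import Data.List.Membership.Propositional.Properties
open import Data.List.Membership.DecPropositional _≟_ using (_∈?_)
open import Data.List.Relation.Binary.Disjoint.Propositional using (Disjoint)
open import Data.List.Relation.Unary.Any using (here; there)
open import Data.List.Relation.Unary.All as All using (All; []; _∷_)
import Data.List.Relation.Unary.All.Properties as All
open import Data.List.Relation.Unary.AllPairs as AllPairs using (AllPairs; []; _∷_)
import Data.List.Relation.Unary.AllPairs.Properties as AllPairs
open import Data.List.Relation.Unary.Unique.Propositional using (Unique)
import Data.List.Relation.Unary.Unique.Propositional.Properties as Unique
open import Data.Product using (Σ; ∃; _×_; _,_; proj₁; proj₂)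
open import Data.Sum using (_⊎_; inj₁; inj₂)
open import Data.Unit using (tt)
open import Data.Vec using (Vec; []; _∷_; lookup; tabulate)
open import Data.Vec.Properties as Vec using (lookup∘tabulate; tabulate∘lookup; tabulate-cong)
open import Function.Base using (_∘_; case_of_)
open import Function.Bundles using (mk⇔)
open import Relation.Binary.Definitions using (tri<; tri≈; tri>)
open import Relation.Binary.PropositionalEquality
open import Relation.Nullary
open import Relation.Nullary.Decidable using (¬?; decidable-stable; map′; _×-dec_; _→-dec_)
open import Relation.Unary using (Decidable)

-- Raney numbers

C-absorb : ∀ m n → suc n * (suc m C suc n) ≡ suc m * (m C n)
C-absorb m zero = begin
  1 * (suc m C 1)   ≡⟨ *-identityˡ _ ⟩
  suc m C 1         ≡⟨ nC1≡n (suc m) ⟩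
  suc m             ≡⟨ *-identityʳ (suc m) ⟨
  suc m * (m C 0)   ∎
  where open ≡-Reasoning
C-absorb zero (suc n) = *-zeroʳ n
C-absorb (suc m) (suc n) = begin
  suc (suc n) * (suc (suc m) C suc (suc n))
    ≡⟨ cong (suc (suc n) *_) (nCk+nC[k+1]≡[n+1]C[k+1] (suc m) (suc n)) ⟨
  suc (suc n) * (A + B)                     ≡⟨ *-distribˡ-+ (suc (suc n)) A B ⟩
  A + suc n * A + suc (suc n) * B
    ≡⟨ cong₂ (λ x y → A + x + y) (C-absorb m n) (C-absorb m (suc n)) ⟩
  A + suc m * (m C n) + suc m * (m C suc n) ≡⟨ +-assoc A _ _ ⟩
  A + (suc m * (m C n) + suc m * (m C suc n))
    ≡⟨ cong (A +_) (*-distribˡ-+ (suc m) (m C n) _) ⟨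
  A + suc m * ((m C n) + (m C suc n))
    ≡⟨ cong (λ x → A + suc m * x) (nCk+nC[k+1]≡[n+1]C[k+1] m n) ⟩
  suc (suc m) * A                           ∎
  where
  open ≡-Reasoning
  A = suc m C suc n
  B = suc m C suc (suc n)

C-step : ∀ n d → suc n * ((n + d) C suc n) ≡ d * ((n + d) C n)
C-step n d = +-cancelˡ-≡ (suc n * A) _ _ (begin
  suc n * A + suc n * B     ≡⟨ *-distribˡ-+ (suc n) A B ⟨
  suc n * (A + B)           ≡⟨ cong (suc n *_) (nCk+nC[k+1]≡[n+1]C[k+1] (n + d) n) ⟩
  suc n * (suc (n + d) C suc n) ≡⟨ C-absorb (n + d) n ⟩
  (suc n + d) * A           ≡⟨ *-distribʳ-+ A (suc n) d ⟩
  suc n * A + d * A         ∎)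
  where
  open ≡-Reasoning
  A = (n + d) C n
  B = (n + d) C suc n

-- `raney p n r` is the coefficient of x^n in B^r, where B = 1 + x B^p. The recursion is B^(r+1) =
-- B^r + x B^(p+r).
raney : ℕ → ℕ → ℕ → ℕ
raney p zero    r       = 1
raney p (suc n) zero    = 0
raney p (suc n) (suc r) = raney p n (p + r) + raney p (suc n) r

-- Both hypotheses involve the same number M = (p+1)(n+1) + r, once with A = C(M, n) and once with B
-- = C(M, n+1). Multiplying by M makes them applicable; what remains is the ratio of A and B, which
-- is `C-step`.
raney-closed-step : ∀ p n r X Y →
  X * (suc p * n + (suc p + r)) ≡ (suc p + r) * ((suc p * n + (suc p + r)) C n) →
  Y * (suc p * suc n + r) ≡ r * ((suc p * suc n + r) C suc n) →
  (X + Y) * (suc p * suc n + suc r) ≡ suc r * ((suc p * suc n + suc r) C suc n)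
raney-closed-step p n r X Y hX hY = *-cancelˡ-≡ _ _ M
  ⦃ >-nonZero {M} (m≤m+n 1 _) ⦄ (begin
  M * ((X + Y) * (suc p * suc n + suc r))
    ≡⟨ cong (λ z → M * ((X + Y) * z)) [M+1] ⟩
  M * ((X + Y) * suc M)               ≡⟨ rearrange M X Y ⟩
  suc M * (X * M + Y * M)             ≡⟨ cong₂ (λ x y → suc M * (x + y)) ihX ihY ⟩
  suc M * ((suc p + r) * A + r * B)   ≡⟨ identity ⟩
  M * (suc r * (A + B))               ≡⟨ cong (λ z → M * (suc r * z)) pascal ⟩
  M * (suc r * ((suc p * suc n + suc r) C suc n)) ∎)
  where
  open ≡-Reasoning
  d = p * n + (suc p + r)
  M = suc p + (n + p * n) + r
  A = M C n
  B = M C suc n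
  [M+1] : suc p * suc n + suc r ≡ suc M
  [M+1] = lem p n r
    where lem : ∀ p n r → suc p * suc n + suc r ≡ suc (suc p + (n + p * n) + r)
          lem = solve-∀
  eqX : suc p * n + (suc p + r) ≡ M
  eqX = lem p n r
    where lem : ∀ p n r → suc p * n + (suc p + r) ≡ suc p + (n + p * n) + r
          lem = solve-∀
  eqY : suc p * suc n + r ≡ M
  eqY = lem p n r
    where lem : ∀ p n r → suc p * suc n + r ≡ suc p + (n + p * n) + r
          lem = solve-∀
  eqD : n + d ≡ M
  eqD = lem p n r
    where lem : ∀ p n r → n + (p * n + (suc p + r)) ≡ suc p + (n + p * n) + r
          lem = solve-∀
  ihX : X * M ≡ (suc p + r) * A
  ihX = subst (λ m → X * m ≡ (suc p + r) * (m C n)) eqX hX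
  ihY : Y * M ≡ r * B
  ihY = subst (λ m → Y * m ≡ r * (m C suc n)) eqY hY
  pascal : A + B ≡ (suc p * suc n + suc r) C suc n
  pascal = trans (nCk+nC[k+1]≡[n+1]C[k+1] M n) (cong (_C suc n) (sym [M+1]))
  rearrange : ∀ m x y → m * ((x + y) * suc m) ≡ suc m * (x * m + y * m)
  rearrange = solve-∀
  stepAB : suc n * B ≡ d * A
  stepAB = subst (λ m → suc n * (m C suc n) ≡ d * (m C n)) eqD (C-step n d)
  identity : suc M * ((suc p + r) * A + r * B) ≡ M * (suc r * (A + B))
  -- Here d = M - n. `split₁` isolates a multiple of d A, which `stepAB` trades for a multiple of (n
  -- + 1) B.
  identity = begin
    suc M * ((suc p + r) * A + r * B)              ≡⟨ split₁ p n r A B ⟩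
    R + suc p * (d * A)                            ≡⟨ cong (λ z → R + suc p * z) stepAB ⟨
    R + suc p * (suc n * B)                        ≡⟨ split₂ p n r A B ⟩
    M * (suc r * (A + B))                          ∎
    where
    R = M * (suc r * A) + suc M * (r * B)
    split₁ : ∀ p n r a b → suc (suc p + (n + p * n) + r) * ((suc p + r) * a + r * b)
      ≡ (suc p + (n + p * n) + r) * (suc r * a) + suc (suc p + (n + p * n) + r) * (r * b) + suc p *
        ((p * n + (suc p + r)) * a)
    split₁ = solve-∀
    split₂ : ∀ p n r a b →
      (suc p + (n + p * n) + r) * (suc r * a) + suc (suc p + (n + p * n) + r) * (r * b) + suc p * (suc n * b)
      ≡ (suc p + (n + p * n) + r) * (suc r * (a + b))
    split₂ = solve-∀

raney-closed : ∀ p n r → raney (suc p) n r * (suc p * n + r) ≡ r * ((suc p * n + r) C n)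
raney-closed p zero r rewrite *-zeroʳ p = trans (*-identityˡ r) (sym (*-identityʳ r))
raney-closed p (suc n) zero = refl
raney-closed p (suc n) (suc r) = raney-closed-step p n r
  (raney (suc p) n (suc p + r)) (raney (suc p) (suc n) r)
  (raney-closed p n (suc p + r)) (raney-closed p (suc n) r)

-- Order embeddings that open a gap, of two labels or of 2q positions

shift : ℕ → ℕ → ℕ → ℕ
shift D t x with x <? t
... | yes _ = x
... | no  _ = D + x

shift-< : ∀ D {t x} → x < t → shift D t x ≡ x
shift-< D {t} {x} x<t with x <? t
... | yes _   = refl
... | no  x≮t = contradiction x<t x≮t

shift-≥ : ∀ D {t x} → t ≤ x → shift D t x ≡ D + x
shift-≥ D {t} {x} t≤x with x <? t
... | yes x<t = contradiction t≤x (<⇒≱ x<t)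
... | no  _   = refl

shift-misses : ∀ D t x → t ≤ shift D t x → ¬ shift D t x < D + t
shift-misses D t x t≤ <D+t with x <? t
... | yes x<t = contradiction t≤ (<⇒≱ x<t)
... | no  x≮t = contradiction (+-monoʳ-≤ D (≮⇒≥ x≮t)) (<⇒≱ <D+t)

shift-injective : ∀ D t {x y} → shift D t x ≡ shift D t y → x ≡ y
shift-injective D t {x} {y} eq with x <? t | y <? t
... | yes _   | yes _   = eq
... | yes x<t | no  y≮t = contradiction (subst (t ≤_) (sym eq) (≤-trans (≮⇒≥ y≮t) (m≤n+m y D))) (<⇒≱ x<t)
... | no  x≮t | yes y<t = contradiction (subst (t ≤_) eq (≤-trans (≮⇒≥ x≮t) (m≤n+m x D))) (<⇒≱ y<t)
... | no  _   | no  _   = +-cancelˡ-≡ D x y eq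

shift-cover : ∀ D t y → (∃ λ x → y ≡ shift D t x) ⊎ (t ≤ y × y < D + t)
shift-cover D t y with y <? t
... | yes y<t = inj₁ (y , sym (shift-< D y<t))
... | no  y≮t with y <? D + t
...   | yes y<D+t = inj₂ (≮⇒≥ y≮t , y<D+t)
...   | no  y≮D+t = inj₁ (y ∸ D , trans (sym D+x≡y)
  (sym (shift-≥ D (+-cancelˡ-≤ D t (y ∸ D) (subst (D + t ≤_) (sym D+x≡y) (≮⇒≥ y≮D+t))))))
  where
  D+x≡y : D + (y ∸ D) ≡ y
  D+x≡y = m+[n∸m]≡n (≤-trans (m≤m+n D t) (≮⇒≥ y≮D+t))

-- Cactus positions and insertions

max-witness : ∀ {P : ℕ → Set} → Decidable P → ∀ B → (∃ λ s → s < B × P s) →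
  ∃ λ s → s < B × P s × (∀ t → s < t → t < B → ¬ P t)
max-witness P? zero (s , () , _)
max-witness P? (suc B) (s , s<1+B , Ps) with P? B
... | yes PB = B , ≤-refl , PB , λ t B<t t<1+B → contradiction (s≤s⁻¹ t<1+B) (<⇒≱ B<t)
... | no ¬PB with m<1+n⇒m<n∨m≡n s<1+B
...   | inj₂ refl = contradiction Ps ¬PB
...   | inj₁ s<B with max-witness P? B (s , s<B , Ps)
...     | s′ , s′<B , Ps′ , max = s′ , m<n⇒m<1+n s′<B , Ps′ , max′
  where
  max′ : ∀ t → s′ < t → t < suc B → ¬ _
  max′ t s′<t t<1+B Pt with m<1+n⇒m<n∨m≡n t<1+B
  ... | inj₁ t<B  = max t s′<t t<B Pt
  ... | inj₂ refl = ¬PB Pt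

module Positions (e : ℕ) where

  q D : ℕ
  q = suc e
  D = q + q

  -- With s = i + u q this says that the path of label u consists of the single move u ↦ u + 1 made
  -- by factor i: the positions in between are label u in the factors that act earlier and label u +
  -- 1 in those that act later.
  Direct : (ℕ → ℕ) → ℕ → Set
  Direct ζ s = ζ s ≡ q + s × (∀ p → s < p → p < q + s → ζ p ≡ p)

  Removable : (ℕ → ℕ) → ℕ → Set
  Removable ζ s = Direct ζ s × Direct ζ (q + s)

  -- These are exactly the s that become the last removable position after an insertion at s, by
  -- `allowed⇒last` and `last⇒allowed`. A direct step at s would make q + s removable as well.
  Allowed : (ℕ → ℕ) → ℕ → Set
  Allowed ζ s = ¬ Direct ζ s × (∀ t → s < t → ¬ Removable ζ t)

  direct? : ∀ ζ → Decidable (Direct ζ)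
  direct? ζ s = (ζ s ≟ q + s) ×-dec
    map′ (λ h p s<p p<q+s → h p<q+s s<p) (λ h {p} p<q+s s<p → h p s<p p<q+s)
         (allUpTo? (λ p → (s <? p) →-dec (ζ p ≟ p)) (q + s))

  removable? : ∀ ζ → Decidable (Removable ζ)
  removable? ζ s = direct? ζ s ×-dec direct? ζ (q + s)

  Direct-cong : ∀ {ζ ξ} → (∀ p → ζ p ≡ ξ p) → ∀ {s} → Direct ζ s → Direct ξ s
  Direct-cong ζ≗ξ (h , f) = trans (sym (ζ≗ξ _)) h , λ p a b → trans (sym (ζ≗ξ p)) (f p a b)

  Removable-cong : ∀ {ζ ξ} → (∀ p → ζ p ≡ ξ p) → ∀ {s} → Removable ζ s → Removable ξ s
  Removable-cong ζ≗ξ (x , y) = Direct-cong ζ≗ξ x , Direct-cong ζ≗ξ y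

  fixed⇒¬Direct : ∀ ζ {s} → ζ s ≡ s → ¬ Direct ζ s
  fixed⇒¬Direct ζ {s} fix (h , _) = m≢1+n+m s (trans (sym fix) h)

  -- ζ′ arises from ζ by inserting 2q positions s, …, s + 2q - 1 and extending
  -- the cycle of s to s ↦ s + q ↦ s + 2q ↦ (old image of s).
  record Insertion (s : ℕ) (ζ ζ′ : ℕ → ℕ) : Set where
    field
      old   : ∀ p → ζ′ (shift D s p) ≡ shift D (suc s) (ζ p)
      new₀  : ζ′ s ≡ q + s
      new₁  : ζ′ (q + s) ≡ D + s
      fixed : ∀ p → s < p → p < D + s → p ≢ q + s → ζ′ p ≡ p

  -- The old position s is split: as an image it stays at s, as an argument it moves to 2q + s.
  -- Hence arguments skip a gap starting at s and images a gap starting at s + 1.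
  insert : (ℕ → ℕ) → ℕ → ℕ → ℕ
  insert ζ s p with p <? s | p <? D + s | p ≟ s | p ≟ q + s
  ... | yes _ | _     | _     | _     = shift D (suc s) (ζ p)
  ... | no  _ | no  _ | _     | _     = shift D (suc s) (ζ (p ∸ D))
  ... | no  _ | yes _ | yes _ | _     = q + s
  ... | no  _ | yes _ | no  _ | yes _ = D + s
  ... | no  _ | yes _ | no  _ | no  _ = p

  s<D+s : ∀ s → s < D + s
  s<D+s s = s≤s (m≤n+m s _)

  q+s<D+s : ∀ s → q + s < D + s
  q+s<D+s s = subst (q + s <_) (sym (+-assoc q q s)) (m<n+m (q + s) z<s)

  insert-insertion : ∀ ζ s → Insertion s ζ (insert ζ s)
  insert-insertion ζ s = record { old = old ; new₀ = new₀ ; new₁ = new₁ ; fixed = fixed }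
    where
    old : ∀ p → insert ζ s (shift D s p) ≡ shift D (suc s) (ζ p)
    old p with p <? s
    old p | yes p<s with p <? s | p <? D + s | p ≟ s | p ≟ q + s
    ... | yes _ | _ | _ | _ = refl
    ... | no p≮s | _ | _ | _ = contradiction p<s p≮s
    old p | no p≮s with D + p <? s | D + p <? D + s | D + p ≟ s | D + p ≟ q + s
    ... | yes x | _ | _ | _ = contradiction (≤-<-trans (m≤n+m p D) x) p≮s
    ... | no _ | yes x | _ | _ = contradiction (+-cancelˡ-< D p s x) p≮s
    ... | no _ | no _ | _ | _ = cong (λ x → shift D (suc s) (ζ x)) (m+n∸m≡n D p)
    new₀ : insert ζ s s ≡ q + s
    new₀ with s <? s | s <? D + s | s ≟ s | s ≟ q + s
    ... | yes x | _ | _ | _ = contradiction x (<-irrefl refl)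
    ... | no _ | no x | _ | _ = contradiction (s<D+s s) x
    ... | no _ | yes _ | yes _ | _ = refl
    ... | no _ | yes _ | no x | _ = contradiction refl x
    new₁ : insert ζ s (q + s) ≡ D + s
    new₁ with q + s <? s | q + s <? D + s | q + s ≟ s | q + s ≟ q + s
    ... | yes x | _ | _ | _ = contradiction (m≤n+m s q) (<⇒≱ x)
    ... | no _ | no x | _ | _ = contradiction (q+s<D+s s) x
    ... | no _ | yes _ | yes x | _ = contradiction (sym x) (m≢1+n+m s)
    ... | no _ | yes _ | no _ | yes _ = refl
    ... | no _ | yes _ | no _ | no x = contradiction refl x
    fixed : ∀ p → s < p → p < D + s → p ≢ q + s → insert ζ s p ≡ p
    fixed p s<p p<D+s p≢q+s with p <? s | p <? D + s | p ≟ s | p ≟ q + s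
    ... | yes x | _ | _ | _ = contradiction (<-trans s<p x) (<-irrefl refl)
    ... | no _ | no x | _ | _ = contradiction p<D+s x
    ... | no _ | yes _ | yes x | _ = contradiction (sym x) (<⇒≢ s<p)
    ... | no _ | yes _ | no _ | yes x = contradiction x p≢q+s
    ... | no _ | yes _ | no _ | no _ = refl

  -- By `shift-cover` every position is either an old or a new one, and the four fields prescribe
  -- the value at each.
  insertion-unique : ∀ {s ζ ξ ζ′ ξ′} → (∀ p → ζ p ≡ ξ p) →
    Insertion s ζ ζ′ → Insertion s ξ ξ′ → ∀ p → ζ′ p ≡ ξ′ p
  insertion-unique {s} ζ≗ξ i j p with shift-cover D s p
  ... | inj₁ (x , refl) =
    trans (Insertion.old i x) (trans (cong (shift D (suc s)) (ζ≗ξ x)) (sym (Insertion.old j x)))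
  ... | inj₂ (s≤p , p<D+s) with p ≟ s | p ≟ q + s
  ...   | yes refl | _        = trans (Insertion.new₀ i) (sym (Insertion.new₀ j))
  ...   | no  _    | yes refl = trans (Insertion.new₁ i) (sym (Insertion.new₁ j))
  ...   | no  p≢s  | no p≢q+s = trans (Insertion.fixed i p s<p p<D+s p≢q+s)
    (sym (Insertion.fixed j p s<p p<D+s p≢q+s))
    where s<p = ≤∧≢⇒< s≤p (λ x → p≢s (sym x))

  insertion-cancel : ∀ {s ζ ξ ζ′ ξ′} → (∀ p → ζ′ p ≡ ξ′ p) →
    Insertion s ζ ζ′ → Insertion s ξ ξ′ → ∀ p → ζ p ≡ ξ p
  insertion-cancel {s} eq i j p = shift-injective D (suc s)
    (trans (sym (Insertion.old i p)) (trans (eq _) (Insertion.old j p)))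

  D+q+t≡q+D+t : ∀ t → D + (q + t) ≡ q + (D + t)
  D+q+t≡q+D+t t = trans (sym (+-assoc D q t)) (trans (cong (_+ t) (+-comm D q)) (+-assoc q D t))

  s<q+t : ∀ {s t} → s ≤ t → s < q + t
  s<q+t {t = t} s≤t = s≤s (≤-trans s≤t (m≤n+m t e))

  module _ {s ζ ζ′} (ι : Insertion s ζ ζ′) where
    open Insertion ι

    insertion-removable : Removable ζ′ s
    insertion-removable =
      (new₀ , λ p s<p p<q+s → fixed p s<p (<-trans p<q+s (q+s<D+s s)) (<⇒≢ p<q+s)) ,
      (trans new₁ (+-assoc q q s) , λ p q+s<p p<2q+s →
        fixed p (≤-<-trans (m≤n+m s q) q+s<p) (subst (p <_) (sym (+-assoc q q s)) p<2q+s)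
          (λ x → <⇒≢ q+s<p (sym x)))

    insertion-tail : ∀ {t} → s ≤ t → ζ′ (D + t) ≡ shift D (suc s) (ζ t)
    insertion-tail {t} s≤t = trans (cong ζ′ (sym (shift-≥ D s≤t))) (old t)

    -- The image q + t and all positions in between lie beyond s, so arguments and images are
    -- shifted by the same 2q in spite of their different gaps.
    direct-shift : ∀ {t} → s ≤ t → Direct ζ t → Direct ζ′ (D + t)
    direct-shift {t} s≤t (h , f) =
      trans (insertion-tail s≤t) (trans (cong (shift D (suc s)) h)
        (trans (shift-≥ D (s<q+t s≤t)) (D+q+t≡q+D+t t))) , fix
      where
      fix : ∀ p → D + t < p → p < q + (D + t) → ζ′ p ≡ p
      fix p D+t<p p<q+D+t with m≤n⇒∃[o]m+o≡n (≤-trans (m≤m+n D t) (<⇒≤ D+t<p))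
      ... | x , refl = trans (insertion-tail (<⇒≤ (≤-<-trans s≤t t<x)))
          (trans (cong (shift D (suc s)) (f x t<x x<q+t)) (shift-≥ D (≤-<-trans s≤t t<x)))
        where
        t<x = +-cancelˡ-< D t x D+t<p
        x<q+t = +-cancelˡ-< D x (q + t) (subst (D + x <_) (sym (D+q+t≡q+D+t t)) p<q+D+t)

    direct-unshift : ∀ {t} → s ≤ t → Direct ζ′ (D + t) → Direct ζ t
    direct-unshift {t} s≤t (h , f) =
      shift-injective D (suc s) (trans (sym (insertion-tail s≤t))
        (trans h (trans (sym (D+q+t≡q+D+t t)) (sym (shift-≥ D (s<q+t s≤t)))))) ,
      λ p t<p p<q+t → let s<p = ≤-<-trans s≤t t<p in
        shift-injective D (suc s) (trans (sym (insertion-tail (<⇒≤ s<p)))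
          (trans (f (D + p) (+-monoʳ-< D t<p) (subst (D + p <_) (D+q+t≡q+D+t t) (+-monoʳ-< D p<q+t)))
            (sym (shift-≥ D s<p))))

    -- If t is beyond 2q + s, the pair already exists in `ζ`. If t = 2q + s, its first step comes
    -- from a direct step of `ζ` at s. Before 2q + s only t = q + s is not fixed, and its second
    -- step starts at 2q + s, which again gives a direct step at s.
    allowed⇒last : Allowed ζ s → ∀ t → s < t → ¬ Removable ζ′ t
    allowed⇒last (¬dir , last) t s<t (d₀ , d₁) with t <? D + s
    ... | no t≮D+s with m≤n⇒∃[o]m+o≡n (≤-trans (m≤m+n D s) (≮⇒≥ t≮D+s))
    ...   | x , refl with m≤n⇒m<n∨m≡n (+-cancelˡ-≤ D s x (≮⇒≥ t≮D+s))
    ...     | inj₂ refl = ¬dir (direct-unshift ≤-refl d₀)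
    ...     | inj₁ s<x  = last x s<x (direct-unshift (<⇒≤ s<x) d₀ ,
                direct-unshift (<⇒≤ (s<q+t (<⇒≤ s<x))) (subst (Direct ζ′) (sym (D+q+t≡q+D+t x)) d₁))
    allowed⇒last (¬dir , last) t s<t (d₀ , d₁) | yes t<D+s with t ≟ q + s
    ... | no  t≢q+s = fixed⇒¬Direct ζ′ (fixed t s<t t<D+s t≢q+s) d₀
    ... | yes refl  = ¬dir (direct-unshift ≤-refl (subst (Direct ζ′) (sym (+-assoc q q s)) d₁))

    last⇒allowed : (∀ t → s < t → ¬ Removable ζ′ t) → Allowed ζ s
    last⇒allowed last =
      (λ d → last (q + s) (s<q+t ≤-refl)
        (proj₂ insertion-removable , subst (Direct ζ′) (+-assoc q q s) (direct-shift ≤-refl d))) ,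
      λ t s<t (d₀ , d₁) → last (D + t) (<-≤-trans s<t (m≤n+m t D))
        (direct-shift (<⇒≤ s<t) d₀ ,
         subst (Direct ζ′) (D+q+t≡q+D+t t) (direct-shift (<⇒≤ (s<q+t (<⇒≤ s<t))) d₁))

-- Codes and their enumeration

total : ∀ {A : Set} → (A → ℕ) → List A → ℕ
total f []       = 0
total f (x ∷ xs) = f x + total f xs

total-++ : ∀ {A : Set} (f : A → ℕ) xs ys → total f (xs ++ ys) ≡ total f xs + total f ys
total-++ f []       ys = refl
total-++ f (x ∷ xs) ys = trans (cong (f x +_) (total-++ f xs ys)) (sym (+-assoc (f x) _ _))

total-map : ∀ {A B : Set} (f : B → ℕ) (g : A → B) xs → total f (map g xs) ≡ total (f ∘ g) xs
total-map f g []       = refl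
total-map f g (x ∷ xs) = cong (f (g x) +_) (total-map f g xs)

total-concatMap : ∀ {A B : Set} (f : B → ℕ) (g : A → List B) xs →
  total f (concatMap g xs) ≡ total (total f ∘ g) xs
total-concatMap f g []       = refl
total-concatMap f g (x ∷ xs) = trans (total-++ f (g x) _) (cong (total f (g x) +_) (total-concatMap f g xs))

total-cong : ∀ {A : Set} {f g : A → ℕ} xs → (∀ {x} → x ∈ xs → f x ≡ g x) → total f xs ≡ total g xs
total-cong []       h = refl
total-cong (x ∷ xs) h = cong₂ _+_ (h (here refl)) (total-cong xs (h ∘ there))

total-1 : ∀ {A : Set} (xs : List A) → total (λ _ → 1) xs ≡ length xs
total-1 []       = refl
total-1 (x ∷ xs) = cong suc (total-1 xs)

-- In a sorted list of r slots the numbers of later slots are r - 1, ..., 1, 0, and unfolding the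
-- recursion of `raney` in its last argument produces exactly these summands.
raney-slots : ∀ p m xs → AllPairs _<_ xs →
  total (λ s → raney p m (p + length (filter (s <?_) xs))) xs ≡ raney p (suc m) (length xs)
raney-slots p m [] [] = refl
raney-slots p m (x ∷ xs) (x<xs ∷ xs-sorted) = cong₂ _+_
  (cong (λ l → raney p m (p + length l)) (trans (filter-reject (x <?_) {x} {xs} (<-irrefl refl))
    (filter-all (x <?_) x<xs)))
  (trans (total-cong xs (λ {s} s∈xs → cong (λ l → raney p m (p + length l))
            (filter-reject (s <?_) {x} {xs} (<-asym (All.lookup x<xs s∈xs)))))
         (raney-slots p m xs xs-sorted))

Unique-concatMap : ∀ {A B : Set} (g : A → List B) {xs} → (∀ x → Unique (g x)) →
  (∀ {x y z} → z ∈ g x → z ∈ g y → x ≡ y) → Unique xs → Unique (concatMap g xs)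
Unique-concatMap g u d []           = []
Unique-concatMap g {x ∷ xs} u d (x∉xs ∷ uxs) = Unique.++⁺ (u x) (Unique-concatMap g u d uxs) disj
  where
  disj : Disjoint (g x) (concatMap g xs)
  disj (z∈gx , z∈rest) with find (∈-concatMap⁻ g {xs = xs} z∈rest)
  ... | y , y∈xs , z∈gy = All.lookup x∉xs y∈xs (d z∈gx z∈gy)

module Codes (e : ℕ) where
  open Positions e

  -- The positions from s + 1 to 2q + s without q + s, where the second direct step of the inserted
  -- pair starts. The last one, 2q + s, is the old s as an argument; it is not direct because s was
  -- allowed.
  fresh : ℕ → List ℕ
  fresh s = applyUpTo (λ x → suc x + s) e ++ applyUpTo (λ x → suc x + (q + s)) q

  -- A code lists the insertion positions, the last insertion first; slots c are
  -- the positions at which the next insertion keeps the code canonical.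
  slots : List ℕ → List ℕ
  slots []      = upTo q
  slots (s ∷ c) = fresh s ++ map (D +_) (filter (s <?_) (slots c))

  decode : List ℕ → ℕ → ℕ
  decode []      = λ p → p
  decode (s ∷ c) = insert (decode c) s

  size : ℕ → ℕ
  size zero    = q
  size (suc k) = D + size k

  codes : ℕ → List (List ℕ)
  codes zero    = [] ∷ []
  codes (suc k) = concatMap (λ c → map (_∷ c) (slots c)) (codes k)

  data Valid : ℕ → List ℕ → Set where
    []  : Valid 0 []
    _∷_ : ∀ {k s c} → s ∈ slots c → Valid k c → Valid (suc k) (s ∷ c)

  codes⇒Valid : ∀ k {c} → c ∈ codes k → Valid k c
  codes⇒Valid zero    (here refl) = []
  codes⇒Valid (suc k) c∈ with find (∈-concatMap⁻ (λ c → map (_∷ c) (slots c)) {xs = codes k} c∈)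
  ... | c₀ , c₀∈ , m with ∈-map⁻ (_∷ c₀) m
  ...   | s , s∈ , refl = s∈ ∷ codes⇒Valid k c₀∈

  Valid⇒codes : ∀ {k c} → Valid k c → c ∈ codes k
  Valid⇒codes []      = here refl
  Valid⇒codes (s∈ ∷ v) = ∈-concatMap⁺ (λ c → map (_∷ c) (slots c)) (lose (Valid⇒codes v) (∈-map⁺ _ s∈))

  fresh-> : ∀ {s t} → t ∈ fresh s → s < t
  fresh-> {s} t∈ with ∈-++⁻ (applyUpTo (λ x → suc x + s) e) t∈
  ... | inj₁ t∈₁ with ∈-applyUpTo⁻ (λ x → suc x + s) t∈₁
  ...   | x , _ , refl = s≤s (m≤n+m s x)
  fresh-> {s} t∈ | inj₂ t∈₂ with ∈-applyUpTo⁻ (λ x → suc x + (q + s)) t∈₂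
  ...   | x , _ , refl = s≤s (≤-trans (m≤n+m s q) (m≤n+m (q + s) x))

  fresh-≤ : ∀ {s t} → t ∈ fresh s → t ≤ D + s
  fresh-≤ {s} t∈ with ∈-++⁻ (applyUpTo (λ x → suc x + s) e) t∈
  ... | inj₁ t∈₁ with ∈-applyUpTo⁻ (λ x → suc x + s) t∈₁
  ...   | x , x<e , refl = +-monoˡ-≤ s (≤-trans (m≤n⇒m≤1+n x<e) (m≤m+n q q))
  fresh-≤ {s} t∈ | inj₂ t∈₂ with ∈-applyUpTo⁻ (λ x → suc x + (q + s)) t∈₂
  ...   | x , x<q , refl = subst (suc x + (q + s) ≤_) (sym (+-assoc q q s)) (+-monoˡ-≤ (q + s) x<q)

  fresh-≢ : ∀ {s t} → t ∈ fresh s → t ≢ q + s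
  fresh-≢ {s} t∈ eq with ∈-++⁻ (applyUpTo (λ x → suc x + s) e) t∈
  ... | inj₁ t∈₁ with ∈-applyUpTo⁻ (λ x → suc x + s) t∈₁
  ...   | x , x<e , refl = <⇒≢ (+-monoˡ-< s (s<s x<e)) eq
  fresh-≢ {s} t∈ eq | inj₂ t∈₂ with ∈-applyUpTo⁻ (λ x → suc x + (q + s)) t∈₂
  ...   | x , x<q , refl = m≢1+n+m (q + s) (sym eq)

  fresh⁺ : ∀ {s t} → s < t → t ≤ D + s → t ≢ q + s → t ∈ fresh s
  fresh⁺ {s} {t} s<t t≤D+s t≢q+s with <-cmp t (q + s)
  ... | tri≈ _ eq _ = contradiction eq t≢q+s
  ... | tri< t<q+s _ _ with m≤n⇒∃[o]m+o≡n s<t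
  ...   | x , refl = subst (_∈ fresh s) (cong suc (+-comm x s))
            (∈-++⁺ˡ (∈-applyUpTo⁺ (λ x → suc x + s)
              (s<s⁻¹ (+-cancelʳ-< s (suc x) q (subst (_< q + s) (cong suc (+-comm s x)) t<q+s)))))
  fresh⁺ {s} {t} s<t t≤D+s t≢q+s | tri> _ _ q+s<t with m≤n⇒∃[o]m+o≡n q+s<t
  ...   | x , refl = subst (_∈ fresh s) (cong suc (+-comm x (q + s)))
            (∈-++⁺ʳ (applyUpTo (λ x → suc x + s) e) (∈-applyUpTo⁺ (λ x → suc x + (q + s))
              (+-cancelʳ-≤ (q + s) (suc x) q
              (subst₂ _≤_ (cong suc (+-comm (q + s) x)) (+-assoc q q s) t≤D+s))))

  length-fresh : ∀ s → length (fresh s) ≡ e + q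
  length-fresh s = trans (length-++ (applyUpTo (λ x → suc x + s) e))
    (cong₂ _+_ (length-applyUpTo (λ x → suc x + s) e) (length-applyUpTo (λ x → suc x + (q + s)) q))

  fresh-sorted : ∀ s → AllPairs _<_ (fresh s)
  fresh-sorted s = AllPairs.++⁺
    (AllPairs.applyUpTo⁺₁ _ e (λ i<j _ → +-monoˡ-< s (s<s i<j)))
    (AllPairs.applyUpTo⁺₁ _ q (λ i<j _ → +-monoˡ-< (q + s) (s<s i<j)))
    (All.applyUpTo⁺₁ _ e (λ i<e → All.applyUpTo⁺₂ _ q (λ j →
      <-≤-trans (+-monoˡ-< s (s<s i<e)) (m≤n+m (q + s) (suc j)))))

  slots-sorted : ∀ c → AllPairs _<_ (slots c)
  slots-sorted []      = AllPairs.applyUpTo⁺₁ _ q (λ i<j _ → i<j)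
  slots-sorted (s ∷ c) = AllPairs.++⁺ (fresh-sorted s)
    (AllPairs.map⁺ (AllPairs.map (+-monoʳ-< D) (AllPairs.filter⁺ (s <?_) (slots-sorted c))))
    (All.tabulate λ t∈ → All.map⁺ (All.map (λ s<x → ≤-<-trans (fresh-≤ t∈) (+-monoʳ-< D s<x))
      (All.all-filter (s <?_) (slots c))))

  codes-unique : ∀ k → Unique (codes k)
  codes-unique zero    = [] ∷ []
  codes-unique (suc k) = Unique-concatMap _
    (λ c → Unique.map⁺ ∷-injectiveˡ (AllPairs.map <⇒≢ (slots-sorted c))) disj (codes-unique k)
    where
    disj : ∀ {c d z} → z ∈ map (_∷ c) (slots c) → z ∈ map (_∷ d) (slots d) → c ≡ d
    disj z∈c z∈d with ∈-map⁻ (_∷ _) z∈c | ∈-map⁻ (_∷ _) z∈d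
    ... | _ , _ , refl | _ , _ , eq = ∷-injectiveʳ eq

  -- The summand at `c` is the number of continuations of `c` by m further insertions, so
  -- lengthening the codes by one and lowering m by one leaves the total unchanged. At m = 0 every
  -- summand is 1 and the total counts the codes.
  raney-codes : ∀ k m → total (λ c → raney (e + q) m (length (slots c))) (codes k) ≡ raney (e + q) (k + m) q
  raney-codes zero m = trans (+-identityʳ _) (cong (raney (e + q) m) (length-applyUpTo (λ x → x) q))
  raney-codes (suc k) m = begin
    total (weight m) (concatMap (λ c → map (_∷ c) (slots c)) (codes k))
      ≡⟨ total-concatMap (weight m) (λ c → map (_∷ c) (slots c)) (codes k) ⟩
    total (λ c → total (weight m) (map (_∷ c) (slots c))) (codes k)
      ≡⟨ total-cong (codes k) (λ {c} _ → step c) ⟩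
    total (weight (suc m)) (codes k)    ≡⟨ raney-codes k (suc m) ⟩
    raney (e + q) (k + suc m) q         ≡⟨ cong (λ x → raney (e + q) x q) (+-suc k m) ⟩
    raney (e + q) (suc k + m) q         ∎
    where
    open ≡-Reasoning
    weight : ℕ → List ℕ → ℕ
    weight m c = raney (e + q) m (length (slots c))
    length-slots : ∀ s c → length (slots (s ∷ c)) ≡ (e + q) + length (filter (s <?_) (slots c))
    length-slots s c = trans (length-++ (fresh s))
      (cong₂ _+_ (length-fresh s) (length-map (D +_) (filter (s <?_) (slots c))))
    step : ∀ c → total (weight m) (map (_∷ c) (slots c)) ≡ weight (suc m) c
    step c = trans (total-map (weight m) (_∷ c) (slots c))
      (trans (total-cong (slots c) (λ {s} _ → cong (raney (e + q) m) (length-slots s c)))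
             (raney-slots (e + q) m (slots c) (slots-sorted c)))

  length-codes : ∀ k → length (codes k) ≡ raney (e + q) k q
  length-codes k = trans (sym (total-1 (codes k)))
    (trans (raney-codes k 0) (cong (λ x → raney (e + q) x q) (+-identityʳ k)))

  -- A slot is later than the preceding insertion position s, so `allowed⇒last` excludes removable
  -- positions beyond it. It is not direct because a fresh position before 2q + s is fixed, and any
  -- other slot comes from a position that was not direct before the insertion.
  slots-sound : ∀ {k c t} → Valid k c → t ∈ slots c → t < size k × Allowed (decode c) t
  slots-sound [] t∈ = ∈-upTo⁻ t∈ , fixed⇒¬Direct _ refl , λ u _ → fixed⇒¬Direct _ refl ∘ proj₁
  slots-sound {suc k} {s ∷ c} {t} (s∈ ∷ v) t∈ with slots-sound v s∈ | ∈-++⁻ (fresh s) t∈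
  ... | s<size , s-ok@(¬dir , last) | inj₁ t∈f =
    ≤-<-trans (fresh-≤ t∈f) (+-monoʳ-< D s<size) , ¬dir′ , λ u t<u → allowed⇒last ι s-ok u
      (<-trans (fresh-> t∈f) t<u)
    where
    ι = insert-insertion (decode c) s
    ¬dir′ : ¬ Direct (decode (s ∷ c)) t
    ¬dir′ d with m≤n⇒m<n∨m≡n (fresh-≤ t∈f)
    ... | inj₁ t<D+s = fixed⇒¬Direct _ (Insertion.fixed ι t (fresh-> t∈f) t<D+s (fresh-≢ t∈f)) d
    ... | inj₂ refl  = ¬dir (direct-unshift ι ≤-refl d)
  ... | s<size , s-ok@(¬dir , last) | inj₂ t∈m with ∈-map⁻ (D +_) t∈m
  ...   | x , x∈f , refl with ∈-filter⁻ (s <?_) {xs = slots c} x∈f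
  ...     | x∈ , s<x with slots-sound v x∈
  ...       | x<size , ¬dir-x , _ = +-monoʳ-< D x<size , ¬dir-x ∘ direct-unshift ι (<⇒≤ s<x) ,
              λ u D+x<u → allowed⇒last ι s-ok u (<-≤-trans s<x (≤-trans (m≤n+m x D) (<⇒≤ D+x<u)))
    where ι = insert-insertion (decode c) s

  -- The inserted pair is removable at s, which excludes t ≤ s. Beyond s, t is either fresh or the
  -- shift of a position that was allowed before.
  slots-complete : ∀ {k c t} → Valid k c → t < size k → Allowed (decode c) t → t ∈ slots c
  slots-complete [] t<q _ = ∈-upTo⁺ t<q
  slots-complete {suc k} {s ∷ c} {t} (s∈ ∷ v) t<size (¬dir , last) with slots-sound v s∈ | <-cmp s t
  ... | _ | tri≈ _ refl _ = contradiction (proj₁ (insertion-removable (insert-insertion (decode c) s))) ¬dir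
  ... | _ | tri> _ _ t<s  = contradiction (insertion-removable (insert-insertion (decode c) s)) (last s t<s)
  ... | s<size , s-ok | tri< s<t _ _ with t ≤? D + s
  ...   | yes t≤D+s = ∈-++⁺ˡ (fresh⁺ s<t t≤D+s (λ { refl → ¬dir
    (proj₂ (insertion-removable (insert-insertion (decode c) s))) }))
  ...   | no  t≰D+s with m≤n⇒∃[o]m+o≡n (≤-trans (m≤m+n D s) (<⇒≤ (≰⇒> t≰D+s)))
  ...     | x , refl = ∈-++⁺ʳ (fresh s) (∈-map⁺ (D +_) (∈-filter⁺ (s <?_)
              (slots-complete v (+-cancelˡ-< D x (size k) t<size)
                (¬dir ∘ direct-shift (insert-insertion (decode c) s) (<⇒≤ s<x) , λ u x<u → proj₂ s-ok u
                  (<-trans s<x x<u))) s<x))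
    where s<x = +-cancelˡ-< D s x (≰⇒> t≰D+s)

  -- The first entry of a code is the last removable position of the decoded map. So equal maps have
  -- equal first entries, and the insertion can be undone.
  decode-injective : ∀ {k c d} → Valid k c → Valid k d → (∀ p → decode c p ≡ decode d p) → c ≡ d
  decode-injective [] [] _ = refl
  decode-injective {c = s ∷ c} {d = t ∷ d} (s∈ ∷ v) (t∈ ∷ w) eq with <-cmp s t
  ... | tri< s<t _ _ = contradiction
    (Removable-cong (sym ∘ eq) (insertion-removable (insert-insertion (decode d) t)))
    (allowed⇒last (insert-insertion (decode c) s) (proj₂ (slots-sound v s∈)) t s<t)
  ... | tri> _ _ t<s = contradiction
    (Removable-cong eq (insertion-removable (insert-insertion (decode c) s)))
    (allowed⇒last (insert-insertion (decode d) t) (proj₂ (slots-sound w t∈)) s t<s)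
  ... | tri≈ _ refl _ = cong (s ∷_) (decode-injective v w
    (insertion-cancel eq (insert-insertion (decode c) s) (insert-insertion (decode d) s)))

-- Independent sets and products of 3-cycles

Unique-⊆⇒length≤ : ∀ {A : Set} {xs ys : List A} → Unique xs → (∀ {x} → x ∈ xs → x ∈ ys) →
  length xs ≤ length ys
Unique-⊆⇒length≤ {xs = []} _ _ = z≤n
Unique-⊆⇒length≤ {xs = x ∷ xs} (x∉xs ∷ uxs) xs⊆ys with ∈-∃++ (xs⊆ys (here refl))
... | as , bs , refl = subst (suc (length xs) ≤_) (sym length≡) (s≤s (Unique-⊆⇒length≤ uxs xs⊆as++bs))
  where
  length≡ : length (as ++ x ∷ bs) ≡ suc (length (as ++ bs))
  length≡ = trans (length-++ as) (trans (+-suc (length as) (length bs)) (cong suc (sym (length-++ as))))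
  xs⊆as++bs : ∀ {y} → y ∈ xs → y ∈ as ++ bs
  xs⊆as++bs y∈xs with ∈-++⁻ as (xs⊆ys (there y∈xs))
  ... | inj₁ y∈as         = ∈-++⁺ˡ y∈as
  ... | inj₂ (here refl)  = contradiction refl (All.lookup x∉xs y∈xs)
  ... | inj₂ (there y∈bs) = ∈-++⁺ʳ as y∈bs

Independent : (ℕ → ℕ) → List ℕ → Set
Independent f S = ∀ {s} → s ∈ S → f s ∉ S

-- The consequence of being a product of m 3-cycles that is followed through the deletion of labels,
-- where no 3-cycles are exhibited.
IndepBound : (ℕ → ℕ) → ℕ → Set
IndepBound f m = ∀ {S} → Unique S → Independent f S → length S ≤ m

InjectiveFun : (ℕ → ℕ) → Set
InjectiveFun f = ∀ {x y} → f x ≡ f y → x ≡ y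

cycle3 : ℕ → ℕ → ℕ → ℕ → ℕ
cycle3 a b d x with x ≟ a | x ≟ b | x ≟ d
... | yes _ | _     | _     = b
... | no  _ | yes _ | _     = d
... | no  _ | no  _ | yes _ = a
... | no  _ | no  _ | no  _ = x

module _ {a b d : ℕ} (a≢b : a ≢ b) (b≢d : b ≢ d) (a≢d : a ≢ d) where

  cycle3-a : cycle3 a b d a ≡ b
  cycle3-a with a ≟ a
  ... | yes _ = refl
  ... | no  h = contradiction refl h

  cycle3-b : cycle3 a b d b ≡ d
  cycle3-b with b ≟ a | b ≟ b
  ... | yes h | _     = contradiction (sym h) a≢b
  ... | no  _ | yes _ = refl
  ... | no  _ | no  h = contradiction refl h

  cycle3-d : cycle3 a b d d ≡ a
  cycle3-d with d ≟ a | d ≟ b | d ≟ d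
  ... | yes h | _     | _     = contradiction (sym h) a≢d
  ... | no  _ | yes h | _     = contradiction (sym h) b≢d
  ... | no  _ | no  _ | yes _ = refl
  ... | no  _ | no  _ | no  h = contradiction refl h

  cycle3-fixed : ∀ {x} → x ≢ a → x ≢ b → x ≢ d → cycle3 a b d x ≡ x
  cycle3-fixed {x} x≢a x≢b x≢d with x ≟ a | x ≟ b | x ≟ d
  ... | yes h | _     | _     = contradiction h x≢a
  ... | no  _ | yes h | _     = contradiction h x≢b
  ... | no  _ | no  _ | yes h = contradiction h x≢d
  ... | no  _ | no  _ | no  _ = refl

cycle3-inverse : ∀ {a b d} → a ≢ b → b ≢ d → a ≢ d → ∀ x → cycle3 d b a (cycle3 a b d x) ≡ x
cycle3-inverse {a} {b} {d} a≢b b≢d a≢d x with x ≟ a | x ≟ b | x ≟ d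
... | yes refl | _        | _        = cycle3-b (≢-sym b≢d) (≢-sym a≢b) (≢-sym a≢d)
... | no  _    | yes refl | _        = cycle3-a (≢-sym b≢d) (≢-sym a≢b) (≢-sym a≢d)
... | no  _    | no  _    | yes refl = cycle3-d (≢-sym b≢d) (≢-sym a≢b) (≢-sym a≢d)
... | no  x≢a  | no  x≢b  | no  x≢d  = cycle3-fixed (≢-sym b≢d) (≢-sym a≢b) (≢-sym a≢d) x≢d x≢b x≢a

cycle3-injective : ∀ {a b d} → a ≢ b → b ≢ d → a ≢ d → InjectiveFun (cycle3 a b d)
cycle3-injective {a} {b} {d} a≢b b≢d a≢d {x} {y} eq = trans (sym (cycle3-inverse a≢b b≢d a≢d x))
  (trans (cong (cycle3 d b a) eq) (cycle3-inverse a≢b b≢d a≢d y))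

cycle3-map : ∀ {h} → InjectiveFun h → ∀ {a b d} → a ≢ b → b ≢ d → a ≢ d →
  ∀ x → cycle3 (h a) (h b) (h d) (h x) ≡ h (cycle3 a b d x)
cycle3-map {h} inj {a} {b} {d} a≢b b≢d a≢d x with x ≟ a | x ≟ b | x ≟ d
... | yes refl | _        | _        = cycle3-a (a≢b ∘ inj) (b≢d ∘ inj) (a≢d ∘ inj)
... | no  _    | yes refl | _        = cycle3-b (a≢b ∘ inj) (b≢d ∘ inj) (a≢d ∘ inj)
... | no  _    | no  _    | yes refl = cycle3-d (a≢b ∘ inj) (b≢d ∘ inj) (a≢d ∘ inj)
... | no  x≢a  | no  x≢b  | no  x≢d  = cycle3-fixed (a≢b ∘ inj) (b≢d ∘ inj) (a≢d ∘ inj) (x≢a ∘ inj)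
  (x≢b ∘ inj) (x≢d ∘ inj)

-- Maps of all natural numbers, compared pointwise, so that inserting labels does not change the
-- type. The 3-cycle added by `snoc` acts first.
data Prod3 (N : ℕ) : ℕ → (ℕ → ℕ) → Set where
  nil  : ∀ {f} → (∀ x → f x ≡ x) → Prod3 N 0 f
  snoc : ∀ {m f g a b d} → a < N → b < N → d < N → a ≢ b → b ≢ d → a ≢ d →
         Prod3 N m g → (∀ x → f x ≡ g (cycle3 a b d x)) → Prod3 N (suc m) f

Prod3-cong : ∀ {N m f g} → (∀ x → f x ≡ g x) → Prod3 N m f → Prod3 N m g
Prod3-cong f≗g (nil h) = nil (λ x → trans (sym (f≗g x)) (h x))
Prod3-cong f≗g (snoc a< b< d< a≢b b≢d a≢d p h) = snoc a< b< d< a≢b b≢d a≢d p (λ x → trans (sym (f≗g x)) (h x))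

Prod3-∘ : ∀ {N m k f g} → Prod3 N m f → Prod3 N k g → Prod3 N (k + m) (f ∘ g)
Prod3-∘ {f = f} p (nil h) = Prod3-cong (λ x → cong f (sym (h x))) p
Prod3-∘ {f = f} p (snoc a< b< d< a≢b b≢d a≢d r h) = snoc a< b< d< a≢b b≢d a≢d (Prod3-∘ p r)
  (λ x → cong f (h x))

Prod3-injective : ∀ {N m f} → Prod3 N m f → InjectiveFun f
Prod3-injective (nil h) eq = trans (sym (h _)) (trans eq (h _))
Prod3-injective (snoc a< b< d< a≢b b≢d a≢d p h) eq =
  cycle3-injective a≢b b≢d a≢d (Prod3-injective p (trans (sym (h _)) (trans eq (h _))))

Prod3-fixed : ∀ {N m f} → Prod3 N m f → ∀ {x} → N ≤ x → f x ≡ x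
Prod3-fixed (nil h) _ = h _
Prod3-fixed (snoc {g = g} a< b< d< a≢b b≢d a≢d p h) {x} N≤x =
  trans (h x) (trans (cong g (cycle3-fixed a≢b b≢d a≢d (ne a<) (ne b<) (ne d<))) (Prod3-fixed p N≤x))
  where
  ne : ∀ {y} → y < _ → x ≢ y
  ne y<N refl = <⇒≱ y<N N≤x

-- If S is independent for g ∘ (a b d), then among the edges that g could have inside S, only the
-- ones leaving b (if a ∉ S), d (if b ∉ S) and a (if d ∉ S) survive, and at most one of these
-- three cases occurs; so S minus one point is independent for g.
IndepBound-snoc : ∀ {f g a b d m} → a ≢ b → b ≢ d → a ≢ d → (∀ x → f x ≡ g (cycle3 a b d x)) →
  IndepBound g m → IndepBound f (suc m)
IndepBound-snoc {f} {g} {a} {b} {d} {m} a≢b b≢d a≢d f≗g∘t bound {S} uS iS = byCases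
  where
  gb : g b ≡ f a
  gb = sym (trans (f≗g∘t a) (cong g (cycle3-a a≢b b≢d a≢d)))
  gd : g d ≡ f b
  gd = sym (trans (f≗g∘t b) (cong g (cycle3-b a≢b b≢d a≢d)))
  ga : g a ≡ f d
  ga = sym (trans (f≗g∘t d) (cong g (cycle3-d a≢b b≢d a≢d)))

  Conflict : ℕ → Set
  Conflict s = (s ≡ b × a ∉ S) ⊎ (s ≡ d × b ∉ S) ⊎ (s ≡ a × d ∉ S)

  conflict : ∀ {s} → s ∈ S → g s ∈ S → Conflict s
  conflict {s} s∈ gs∈ with s ≟ b | s ≟ d | s ≟ a
  ... | yes refl | _ | _ = inj₁ (refl , λ a∈ → iS a∈ (subst (_∈ S) gb gs∈))
  ... | no _ | yes refl | _ = inj₂ (inj₁ (refl , λ b∈ → iS b∈ (subst (_∈ S) gd gs∈)))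
  ... | no _ | no _ | yes refl = inj₂ (inj₂ (refl , λ d∈ → iS d∈ (subst (_∈ S) ga gs∈)))
  ... | no s≢b | no s≢d | no s≢a = contradiction
    (subst (_∈ S) (sym (trans (f≗g∘t s) (cong g (cycle3-fixed a≢b b≢d a≢d s≢a s≢b s≢d)))) gs∈) (iS s∈)

  remove : ∀ x → (∀ {s} → s ∈ S → g s ∈ S → s ≡ x) → length S ≤ suc m
  remove x only = ≤-trans
    (Unique-⊆⇒length≤ {ys = x ∷ S′} uS (cover _))
    (s≤s (bound (Unique.filter⁺ (λ y → ¬? (y ≟ x)) uS) iS′))
    where
    S′ = filter (λ y → ¬? (y ≟ x)) S
    cover : ∀ y → y ∈ S → y ∈ x ∷ S′
    cover y y∈ with y ≟ x
    ... | yes refl = here refl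
    ... | no  y≢x  = there (∈-filter⁺ (λ y → ¬? (y ≟ x)) y∈ y≢x)
    iS′ : Independent g S′
    iS′ s∈ gs∈ with ∈-filter⁻ (λ y → ¬? (y ≟ x)) {xs = S} s∈
    ... | s∈S , s≢x = s≢x (only s∈S (proj₁ (∈-filter⁻ (λ y → ¬? (y ≟ x)) {xs = S} gs∈)))

  byCases : length S ≤ suc m
  byCases with a ∈? S | b ∈? S | d ∈? S
  ... | yes a∈ | yes b∈ | _ = remove a λ s∈ gs∈ → case conflict s∈ gs∈ of λ where
    (inj₁ (_ , a∉))        → contradiction a∈ a∉
    (inj₂ (inj₁ (_ , b∉))) → contradiction b∈ b∉
    (inj₂ (inj₂ (eq , _))) → eq
  ... | yes a∈ | no b∉ | yes d∈ = remove d λ s∈ gs∈ → case conflict s∈ gs∈ of λ where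
    (inj₁ (_ , a∉))        → contradiction a∈ a∉
    (inj₂ (inj₁ (eq , _))) → eq
    (inj₂ (inj₂ (_ , d∉))) → contradiction d∈ d∉
  ... | yes a∈ | no b∉ | no d∉ = remove a λ s∈ gs∈ → case conflict s∈ gs∈ of λ where
    (inj₁ (refl , _))        → contradiction s∈ b∉
    (inj₂ (inj₁ (refl , _))) → contradiction s∈ d∉
    (inj₂ (inj₂ (eq , _)))   → eq
  ... | no a∉ | yes b∈ | _ = remove b λ s∈ gs∈ → case conflict s∈ gs∈ of λ where
    (inj₁ (eq , _))          → eq
    (inj₂ (inj₁ (_ , b∉)))   → contradiction b∈ b∉
    (inj₂ (inj₂ (refl , _))) → contradiction s∈ a∉
  ... | no a∉ | no b∉ | _ = remove d λ s∈ gs∈ → case conflict s∈ gs∈ of λ where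
    (inj₁ (refl , _))        → contradiction s∈ b∉
    (inj₂ (inj₁ (eq , _)))   → eq
    (inj₂ (inj₂ (refl , _))) → contradiction s∈ a∉

Prod3⇒IndepBound : ∀ {N m f} → Prod3 N m f → IndepBound f m
Prod3⇒IndepBound (nil h) {[]}    _ _  = z≤n
Prod3⇒IndepBound (nil h) {s ∷ S} _ iS = contradiction (here (h s)) (iS (here refl))
Prod3⇒IndepBound (snoc _ _ _ a≢b b≢d a≢d p h) = IndepBound-snoc a≢b b≢d a≢d h (Prod3⇒IndepBound p)

-- Inserting two consecutive labels

-- The gaps in domain and codomain may differ, which makes the relation composable: in
-- `comp-extends` the codomain gap of one factor is the domain gap of the next.
record Extends (t t′ : ℕ) (f g : ℕ → ℕ) : Set where
  field
    at₀ : f t ≡ t′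
    at₁ : f (suc t) ≡ suc t′
    old : ∀ x → f (shift 2 t x) ≡ shift 2 t′ (g x)

label-cover : ∀ t y → (∃ λ x → y ≡ shift 2 t x) ⊎ (y ≡ t ⊎ y ≡ suc t)
label-cover t y with shift-cover 2 t y
... | inj₁ h = inj₁ h
... | inj₂ (t≤y , y<2+t) with m≤n⇒m<n∨m≡n t≤y
...   | inj₂ refl = inj₂ (inj₁ refl)
...   | inj₁ t<y  = inj₂ (inj₂ (≤-antisym (s≤s⁻¹ y<2+t) t<y))

shift≢t : ∀ t x → shift 2 t x ≢ t
shift≢t t x eq = shift-misses 2 t x (≤-reflexive (sym eq)) (subst (_< 2 + t) (sym eq) (m<n+m t z<s))

shift≢1+t : ∀ t x → shift 2 t x ≢ suc t
shift≢1+t t x eq = shift-misses 2 t x (subst (t ≤_) (sym eq) (n≤1+n t)) (subst (_< 2 + t) (sym eq) ≤-refl)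

shift-bound : ∀ {N x} t → x < N → shift 2 t x < 2 + N
shift-bound {N} {x} t x<N with x <? t
... | yes _ = m≤n⇒m≤o+n 2 x<N
... | no  _ = s<s (s<s x<N)

extend : ℕ → ℕ → (ℕ → ℕ) → ℕ → ℕ
extend t t′ g y with label-cover t y
... | inj₁ (x , _)  = shift 2 t′ (g x)
... | inj₂ (inj₁ _) = t′
... | inj₂ (inj₂ _) = suc t′

extend-extends : ∀ t t′ g → Extends t t′ (extend t t′ g) g
extend-extends t t′ g = record { at₀ = at₀ ; at₁ = at₁ ; old = old }
  where
  at₀ : extend t t′ g t ≡ t′
  at₀ with label-cover t t
  ... | inj₁ (x , eq)  = contradiction (sym eq) (shift≢t t x)
  ... | inj₂ (inj₁ _)  = refl
  ... | inj₂ (inj₂ eq) = contradiction eq (m≢1+n+m t)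
  at₁ : extend t t′ g (suc t) ≡ suc t′
  at₁ with label-cover t (suc t)
  ... | inj₁ (x , eq)  = contradiction (sym eq) (shift≢1+t t x)
  ... | inj₂ (inj₁ eq) = contradiction (sym eq) (m≢1+n+m t)
  ... | inj₂ (inj₂ _)  = refl
  old : ∀ x → extend t t′ g (shift 2 t x) ≡ shift 2 t′ (g x)
  old x with label-cover t (shift 2 t x)
  ... | inj₁ (y , eq)  = cong (shift 2 t′ ∘ g) (sym (shift-injective 2 t eq))
  ... | inj₂ (inj₁ eq) = contradiction eq (shift≢t t x)
  ... | inj₂ (inj₂ eq) = contradiction eq (shift≢1+t t x)

-- The two values in the codomain gap are taken at t and t + 1. By injectivity all other labels
-- avoid them, so their images are shifted labels.
restrict : ∀ {f t t′} → InjectiveFun f → f t ≡ t′ → f (suc t) ≡ suc t′ → ∃ (Extends t t′ f)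
restrict {f} {t} {t′} inj f₀ f₁ = (proj₁ ∘ image) , record { at₀ = f₀ ; at₁ = f₁ ; old = proj₂ ∘ image }
  where
  image : ∀ x → ∃ λ y → f (shift 2 t x) ≡ shift 2 t′ y
  image x with label-cover t′ (f (shift 2 t x))
  ... | inj₁ h         = h
  ... | inj₂ (inj₁ eq) = contradiction (inj (trans eq (sym f₀))) (shift≢t t x)
  ... | inj₂ (inj₂ eq) = contradiction (inj (trans eq (sym f₁))) (shift≢1+t t x)

module _ {t t′ f g} (ε : Extends t t′ f g) where
  open Extends ε

  restriction-injective : InjectiveFun f → InjectiveFun g
  restriction-injective inj eq = shift-injective 2 t
    (inj (trans (old _) (trans (cong (shift 2 t′) eq) (sym (old _)))))

  restriction-fixed : ∀ {N} → t ≤ N → t′ ≤ N → (∀ {x} → 2 + N ≤ x → f x ≡ x) → ∀ {x} → N ≤ x → g x ≡ x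
  restriction-fixed {N} t≤N t′≤N fix {x} N≤x = shift-injective 2 t′ (begin
    shift 2 t′ (g x)  ≡⟨ old x ⟨
    f (shift 2 t x)   ≡⟨ cong f (shift-≥ 2 (≤-trans t≤N N≤x)) ⟩
    f (2 + x)         ≡⟨ fix (+-monoʳ-≤ 2 N≤x) ⟩
    2 + x             ≡⟨ shift-≥ 2 (≤-trans t′≤N N≤x) ⟨
    shift 2 t′ x      ∎)
    where open ≡-Reasoning

IndepBound-restrict : ∀ {t f g m} → Extends t t f g → IndepBound f m → IndepBound g m
IndepBound-restrict {t} {f} {g} {m} ε bound {S} uS iS =
  subst (_≤ m) (length-map (shift 2 t) S) (bound (Unique.map⁺ (shift-injective 2 t) uS) indep)
  where
  indep : Independent f (map (shift 2 t) S)
  indep s∈ fs∈ with ∈-map⁻ (shift 2 t) s∈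
  ... | x , x∈ , refl with ∈-map⁻ (shift 2 t) fs∈
  ...   | y , y∈ , eq = iS x∈ (subst (_∈ S) (sym (shift-injective 2 t (trans (sym (Extends.old ε x)) eq))) y∈)

shift-suc : ∀ {t x} → x ≢ t → shift 2 (suc t) x ≡ shift 2 t x
shift-suc {t} {x} x≢t with x <? t
... | yes x<t = shift-< 2 (m<n⇒m<1+n x<t)
... | no  x≮t = shift-≥ 2 (≤∧≢⇒< (≮⇒≥ x≮t) (≢-sym x≢t))

-- Adding u + 2 (if u ∈ S) or u + 1 (otherwise) to the shifted copy of S keeps it independent.
IndepBound-shrink : ∀ {u f g m} → InjectiveFun f → Extends u (suc u) f g → IndepBound f m →
  ∀ {S} → Unique S → Independent g S → suc (length S) ≤ m
IndepBound-shrink {u} {f} {g} {m} inj ε bound {S} uS iS = byCases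
  where
  open Extends ε
  S′ = map (shift 2 (suc u)) S

  ∉S′ : ∀ {y} → (∀ x → y ≢ shift 2 (suc u) x) → y ∉ S′
  ∉S′ h y∈ with ∈-map⁻ (shift 2 (suc u)) y∈
  ... | x , _ , eq = h x eq

  1+u∉ : suc u ∉ S′
  1+u∉ = ∉S′ λ x eq → shift≢t (suc u) x (sym eq)

  2+u∉ : 2 + u ∉ S′
  2+u∉ = ∉S′ λ x eq → shift≢1+t (suc u) x (sym eq)

  g∉⇒shift∉ : ∀ {y} → y ∉ S → shift 2 (suc u) y ∉ S′
  g∉⇒shift∉ y∉ y∈ with ∈-map⁻ (shift 2 (suc u)) y∈
  ... | x , x∈ , eq = y∉ (subst (_∈ S) (sym (shift-injective 2 (suc u) eq)) x∈)

  iS′ : Independent f S′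
  iS′ s∈ with ∈-map⁻ (shift 2 (suc u)) s∈
  -- The copy of S is made with the codomain gap of `f`. As an argument only u is affected: its
  -- image is now the new label u + 1, which is not in the copy.
  ... | x , x∈ , refl with x ≟ u
  ...   | yes refl = subst (_∉ S′) (sym (trans (cong f (shift-< 2 (n<1+n u))) at₀)) 1+u∉
  ...   | no  x≢u  = subst (_∉ S′) (sym (trans (cong f (shift-suc x≢u)) (old x))) (g∉⇒shift∉ (iS x∈))

  enlarge : ∀ y → y ∉ S′ → f y ≢ y → f y ∉ S′ → (∀ {s} → s ∈ S′ → f s ≢ y) → suc (length S) ≤ m
  enlarge y y∉ fy≢y fy∉ fs≢y = subst (λ l → suc l ≤ m) (length-map (shift 2 (suc u)) S)
    (bound (All.¬Any⇒All¬ S′ y∉ ∷ Unique.map⁺ (shift-injective 2 (suc u)) uS) indep)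
    where
    indep : Independent f (y ∷ S′)
    indep (here refl) (here eq)  = fy≢y eq
    indep (here refl) (there h)  = fy∉ h
    indep (there s∈)  (here eq)  = fs≢y s∈ eq
    indep (there s∈)  (there h)  = iS′ s∈ h

  byCases : suc (length S) ≤ m
  byCases with u ∈? S
  ... | yes u∈ = enlarge (2 + u) 2+u∉ (λ eq → shift≢1+t (suc u) (g u) (trans (sym f[2+u]) eq))
      (subst (_∉ S′) (sym f[2+u]) (g∉⇒shift∉ (iS u∈)))
      (λ s∈ eq → 1+u∉ (subst (_∈ S′) (inj (trans eq (sym at₁))) s∈))
    where
    f[2+u] : f (2 + u) ≡ shift 2 (suc u) (g u)
    f[2+u] = trans (cong f (sym (shift-≥ 2 {u} ≤-refl))) (old u)
  ... | no u∉ = enlarge (suc u) 1+u∉ (λ eq → m≢1+n+m (suc u) {0} (trans (sym eq) at₁))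
      (subst (_∉ S′) (sym at₁) 2+u∉)
      (λ s∈ eq → g∉⇒shift∉ u∉ (subst (_∈ S′) (trans (inj (trans eq (sym at₀)))
        (sym (shift-< 2 (n<1+n u)))) s∈))

-- With equal gaps the new labels are fixed points, so shifting the entries of all 3-cycles gives a
-- product of the same length.
Prod3-extend : ∀ {N m t f g} → Extends t t f g → Prod3 N m g → Prod3 (2 + N) m f
Prod3-extend {t = t} {f} ε (nil h) = nil id≗f
  where
  open Extends ε
  id≗f : ∀ y → f y ≡ y
  id≗f y with label-cover t y
  ... | inj₁ (x , refl)    = trans (old x) (cong (shift 2 t) (h x))
  ... | inj₂ (inj₁ refl) = at₀
  ... | inj₂ (inj₂ refl) = at₁
Prod3-extend {t = t} {f} ε (snoc {g = g₀} {a} {b} {d} a< b< d< a≢b b≢d a≢d p h) =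
  snoc (shift-bound t a<) (shift-bound t b<) (shift-bound t d<) a≢b′ b≢d′ a≢d′
    (Prod3-extend (extend-extends t t g₀) p) f≗
  where
  inj = shift-injective 2 t
  a≢b′ = a≢b ∘ inj
  b≢d′ = b≢d ∘ inj
  a≢d′ = a≢d ∘ inj
  module X = Extends (extend-extends t t g₀)
  open Extends ε
  f≗ : ∀ y → f y ≡ extend t t g₀ (cycle3 (shift 2 t a) (shift 2 t b) (shift 2 t d) y)
  f≗ y with label-cover t y
  ... | inj₁ (x , refl)  = trans (old x) (trans (cong (shift 2 t) (h x))
    (trans (sym (X.old _)) (cong (extend t t g₀) (sym (cycle3-map inj a≢b b≢d a≢d x)))))
  ... | inj₂ (inj₁ refl) = trans at₀ (trans (sym X.at₀) (cong (extend t t g₀)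
    (sym (cycle3-fixed a≢b′ b≢d′ a≢d′ (≢-sym (shift≢t t a)) (≢-sym (shift≢t t b)) (≢-sym (shift≢t t d))))))
  ... | inj₂ (inj₂ refl) = trans at₁ (trans (sym X.at₁) (cong (extend t t g₀)
    (sym (cycle3-fixed a≢b′ b≢d′ a≢d′ (≢-sym (shift≢1+t t a)) (≢-sym (shift≢1+t t b))
      (≢-sym (shift≢1+t t d))))))

-- `f` is the 3-cycle u ↦ u + 1 ↦ u + 2 ↦ u followed by `g` with fixed points inserted at u + 1 and
-- u + 2.
Prod3-grow : ∀ {N m u f g} → u < N → Extends u (suc u) f g → Prod3 N m g → Prod3 (2 + N) (suc m) f
Prod3-grow {u = u} {f} {g} u<N ε p =
  snoc (m<n⇒m<1+n (m<n⇒m<1+n u<N)) (m<n⇒m<1+n (s<s u<N)) (s<s (s<s u<N)) u≢1+u 1+u≢2+u u≢2+u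
    (Prod3-extend (extend-extends (suc u) (suc u) g) p) f≗
  where
  u≢1+u = m≢1+n+m u {0}
  1+u≢2+u = m≢1+n+m (suc u) {0}
  u≢2+u = m≢1+n+m u {1}
  f″ = extend (suc u) (suc u) g
  module X = Extends (extend-extends (suc u) (suc u) g)
  open Extends ε
  f≗ : ∀ y → f y ≡ f″ (cycle3 u (1 + u) (2 + u) y)
  f≗ y with label-cover u y
  ... | inj₂ (inj₁ refl) = trans at₀ (trans (sym X.at₀) (cong f″ (sym (cycle3-a u≢1+u 1+u≢2+u u≢2+u))))
  ... | inj₂ (inj₂ refl) = trans at₁ (trans (sym X.at₁) (cong f″ (sym (cycle3-b u≢1+u 1+u≢2+u u≢2+u))))
  ... | inj₁ (x , refl) with x ≟ u
  ...   | yes refl = trans (old u) (trans (sym (X.old u)) (cong f″ (trans (shift-< 2 (n<1+n u))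
            (sym (trans (cong (cycle3 u (1 + u) (2 + u)) (shift-≥ 2 {u} ≤-refl))
              (cycle3-d u≢1+u 1+u≢2+u u≢2+u))))))
  ...   | no x≢u = trans (old x) (trans (sym (X.old x)) (cong f″ (trans (shift-suc x≢u)
            (sym (cycle3-fixed u≢1+u 1+u≢2+u u≢2+u (shift≢t u x) (shift≢1+t u x)
              (λ eq → shift≢1+t (suc u) x (trans (shift-suc x≢u) eq)))))))

comp : ℕ → (ℕ → ℕ → ℕ) → ℕ → ℕ
comp zero    w u = u
comp (suc k) w u = w 0 (comp k (w ∘ suc) u)

comp-extends : ∀ k (τ : ℕ → ℕ) {w w′} → (∀ {j} → j < k → Extends (τ (suc j)) (τ j) (w′ j) (w j)) →
  Extends (τ k) (τ 0) (comp k w′) (comp k w)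
comp-extends zero    τ h = record { at₀ = refl ; at₁ = refl ; old = λ _ → refl }
comp-extends (suc k) τ {w} {w′} h = record
  { at₀ = trans (cong (w′ 0) T.at₀) H.at₀
  ; at₁ = trans (cong (w′ 0) T.at₁) H.at₁
  ; old = λ x → trans (cong (w′ 0) (T.old x)) (H.old _) }
  where
  module T = Extends (comp-extends k (τ ∘ suc) (h ∘ s<s))
  module H = Extends (h z<s)

-- Existence of a removable pair

-- A greedily chosen independent I inside `L` leaves no point that could be added: each x in `L`
-- satisfies x ∈ I, x ∈ f I or f x ∈ I. So f L lies in the union of f I, f f I and I.
moved-bound : ∀ {f m} → InjectiveFun f → IndepBound f m →
  ∀ {L} → Unique L → (∀ {x} → x ∈ L → f x ≢ x) → length L ≤ 3 * m
moved-bound {f} {m} inj bound {L} uL moved =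
  let (I , _ , uI , iI , near) = greedy uL moved in ≤-trans (covered I near) (*-monoʳ-≤ 3 (bound uI iI))
  where
  Near : List ℕ → ℕ → Set
  Near I x = x ∈ I ⊎ x ∈ map f I ⊎ f x ∈ I

  Near-∷ : ∀ {y I x} → Near I x → Near (y ∷ I) x
  Near-∷ (inj₁ h)        = inj₁ (there h)
  Near-∷ (inj₂ (inj₁ h)) = inj₂ (inj₁ (there h))
  Near-∷ (inj₂ (inj₂ h)) = inj₂ (inj₂ (there h))

  greedy : ∀ {L} → Unique L → (∀ {x} → x ∈ L → f x ≢ x) →
    ∃ λ I → (∀ {x} → x ∈ I → x ∈ L) × Unique I × Independent f I × (∀ {x} → x ∈ L → Near I x)
  greedy [] _ = [] , (λ ()) , [] , (λ ()) , λ ()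
  greedy {x ∷ L} (x∉L ∷ uL) moved with greedy uL (moved ∘ there)
  ... | I , I⊆L , uI , iI , near with x ∈? map f I | f x ∈? I
  ...   | yes h | _ = I , there ∘ I⊆L , uI , iI , λ { (here refl) → inj₂ (inj₁ h) ; (there y∈) → near y∈ }
  ...   | no _ | yes h = I , there ∘ I⊆L , uI , iI , λ { (here refl) → inj₂ (inj₂ h) ; (there y∈) → near y∈ }
  ...   | no x∉fI | no fx∉I = x ∷ I , (λ { (here refl) → here refl ; (there y∈) → there (I⊆L y∈) }) ,
          All.tabulate (λ y∈ → All.lookup x∉L (I⊆L y∈)) ∷ uI , indep ,
          λ { (here refl) → inj₁ (here refl) ; (there y∈) → Near-∷ (near y∈) }
    where
    indep : Independent f (x ∷ I)
    indep (here refl) (here eq)  = moved (here refl) eq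
    indep (here refl) (there h)  = fx∉I h
    indep (there y∈)  (here eq)  = x∉fI (subst (_∈ map f I) eq (∈-map⁺ f y∈))
    indep (there y∈)  (there h)  = iI y∈ h

  covered : ∀ I → (∀ {x} → x ∈ L → Near I x) → length L ≤ 3 * length I
  covered I near = subst₂ _≤_ (length-map f L) length≡ (Unique-⊆⇒length≤ (Unique.map⁺ inj uL) ⊆)
    where
    length≡ : length (map f I ++ (map f (map f I) ++ I)) ≡ 3 * length I
    length≡ = trans (length-++ (map f I)) (cong₂ _+_ (length-map f I)
      (trans (length-++ (map f (map f I))) (cong₂ _+_ (trans (length-map f (map f I)) (length-map f I))
        (sym (+-identityʳ _)))))
    ⊆ : ∀ {y} → y ∈ map f L → y ∈ map f I ++ (map f (map f I) ++ I)
    ⊆ y∈ with ∈-map⁻ f y∈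
    ... | x , x∈ , refl with near x∈
    ...   | inj₁ x∈I         = ∈-++⁺ˡ (∈-map⁺ f x∈I)
    ...   | inj₂ (inj₁ x∈fI) = ∈-++⁺ʳ (map f I) (∈-++⁺ˡ (∈-map⁺ f x∈fI))
    ...   | inj₂ (inj₂ fx∈I) = ∈-++⁺ʳ (map f I) (∈-++⁺ʳ (map f (map f I)) fx∈I)

-- Finite sums and indicators

sumTo : ℕ → (ℕ → ℕ) → ℕ
sumTo zero    f = 0
sumTo (suc n) f = f n + sumTo n f

sumTo-cong : ∀ n {f g} → (∀ {i} → i < n → f i ≡ g i) → sumTo n f ≡ sumTo n g
sumTo-cong zero    h = refl
sumTo-cong (suc n) h = cong₂ _+_ (h ≤-refl) (sumTo-cong n (h ∘ m<n⇒m<1+n))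

sumTo-mono : ∀ n {f g} → (∀ {i} → i < n → f i ≤ g i) → sumTo n f ≤ sumTo n g
sumTo-mono zero    h = z≤n
sumTo-mono (suc n) h = +-mono-≤ (h ≤-refl) (sumTo-mono n (h ∘ m<n⇒m<1+n))

sumTo-+ : ∀ n f g → sumTo n (λ i → f i + g i) ≡ sumTo n f + sumTo n g
sumTo-+ zero    f g = refl
sumTo-+ (suc n) f g = trans (cong (f n + g n +_) (sumTo-+ n f g)) (+-interchange (f n) (g n) _ _)
  where
  +-interchange : ∀ a b c d → a + b + (c + d) ≡ (a + c) + (b + d)
  +-interchange a b c d = trans (+-assoc a b (c + d)) (trans (cong (a +_) (trans (sym (+-assoc b c d))
    (trans (cong (_+ d) (+-comm b c)) (+-assoc c b d)))) (sym (+-assoc a c (b + d))))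

sumTo-const : ∀ n c → sumTo n (λ _ → c) ≡ n * c
sumTo-const zero    c = refl
sumTo-const (suc n) c = cong (c +_) (sumTo-const n c)

sumTo-swap : ∀ m n (f : ℕ → ℕ → ℕ) → sumTo m (λ i → sumTo n (f i)) ≡ sumTo n (λ j → sumTo m (λ i → f i j))
sumTo-swap zero    n f = sym (trans (sumTo-const n 0) (*-zeroʳ n))
sumTo-swap (suc m) n f = trans (cong (sumTo n (f m) +_) (sumTo-swap m n f)) (sym (sumTo-+ n (f m) _))

sumTo-front : ∀ n f → sumTo (suc n) f ≡ f 0 + sumTo n (f ∘ suc)
sumTo-front zero    f = refl
sumTo-front (suc n) f = begin
  f (suc n) + sumTo (suc n) f               ≡⟨ cong (f (suc n) +_) (sumTo-front n f) ⟩
  f (suc n) + (f 0 + sumTo n (f ∘ suc))     ≡⟨ +-assoc (f (suc n)) (f 0) _ ⟨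
  f (suc n) + f 0 + sumTo n (f ∘ suc)       ≡⟨ cong (_+ sumTo n (f ∘ suc)) (+-comm (f (suc n)) (f 0)) ⟩
  f 0 + f (suc n) + sumTo n (f ∘ suc)       ≡⟨ +-assoc (f 0) (f (suc n)) _ ⟩
  f 0 + sumTo (suc n) (f ∘ suc)             ∎
  where open ≡-Reasoning

sumTo-term : ∀ n f {i} → i < n → f i ≤ sumTo n f
sumTo-term (suc n) f i<1+n with m<1+n⇒m<n∨m≡n i<1+n
... | inj₁ i<n  = ≤-trans (sumTo-term n f i<n) (m≤n+m _ (f n))
... | inj₂ refl = m≤m+n (f n) _

indicator : ∀ {P : Set} → Dec P → ℕ
indicator (yes _) = 1
indicator (no  _) = 0

indicator-yes : ∀ {P : Set} (P? : Dec P) → P → indicator P? ≡ 1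
indicator-yes (yes _) _ = refl
indicator-yes (no ¬p) p = contradiction p ¬p

sumTo-indicator : ∀ n {P : ℕ → Set} (P? : Decidable P) → sumTo n (indicator ∘ P?) ≡ length
  (filter P? (downFrom n))
sumTo-indicator zero    P? = refl
sumTo-indicator (suc n) P? with P? n
... | yes _ = cong suc (sumTo-indicator n P?)
... | no  _ = sumTo-indicator n P?

-- Moves along the paths of labels

moved? : ∀ (f : ℕ → ℕ) x → Dec (f x ≢ x)
moved? f x = ¬? (f x ≟ x)

moves : ℕ → (ℕ → ℕ → ℕ) → ℕ → ℕ
moves zero    w u = 0
moves (suc k) w u = indicator (moved? (w 0) (comp k (w ∘ suc) u)) + moves k (w ∘ suc) u

comp-injective : ∀ k {w} → (∀ {j} → j < k → InjectiveFun (w j)) → InjectiveFun (comp k w)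
comp-injective zero    inj eq = eq
comp-injective (suc k) inj eq = comp-injective k (inj ∘ s<s) (inj z<s eq)

-- Count by factors instead of labels: the labels that arrive at a given factor along the N paths
-- are distinct, so `moved-bound` applies to those that it moves.
moves-bound : ∀ N k {w m} → (∀ {j} → j < k → InjectiveFun (w j)) → (∀ {j} → j < k → IndepBound (w j) (m j)) →
  sumTo N (moves k w) ≤ 3 * sumTo k m
moves-bound N zero inj bound = ≤-reflexive (trans (sumTo-const N 0) (*-zeroʳ N))
moves-bound N (suc k) {w} {m} inj bound = begin
  sumTo N (λ u → indicator (P? u) + moves k (w ∘ suc) u)        ≡⟨ sumTo-+ N (indicator ∘ P?) _ ⟩
  sumTo N (indicator ∘ P?) + sumTo N (moves k (w ∘ suc))        ≤⟨ +-mono-≤ first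
    (moves-bound N k (inj ∘ s<s) (bound ∘ s<s)) ⟩
  3 * m 0 + 3 * sumTo k (m ∘ suc)                               ≡⟨ *-distribˡ-+ 3 (m 0) _ ⟨
  3 * (m 0 + sumTo k (m ∘ suc))                                 ≡⟨ cong (3 *_) (sumTo-front k m) ⟨
  3 * sumTo (suc k) m                                           ∎
  where
  open ≤-Reasoning
  V = comp k (w ∘ suc)
  P? = λ u → moved? (w 0) (V u)
  L = filter P? (downFrom N)
  first : sumTo N (indicator ∘ P?) ≤ 3 * m 0
  first = begin
    sumTo N (indicator ∘ P?)  ≡⟨ sumTo-indicator N P? ⟩
    length L                  ≡⟨ length-map V L ⟨
    length (map V L)          ≤⟨ moved-bound (inj z<s) (bound z<s)
                                   (Unique.map⁺ (comp-injective k (inj ∘ s<s))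
                                     (Unique.filter⁺ P? (Unique.downFrom⁺ N))) all-moved ⟩
    3 * m 0                   ∎
    where
    all-moved : ∀ {x} → x ∈ map V L → w 0 x ≢ x
    all-moved x∈ with ∈-map⁻ V x∈
    ... | u , u∈ , refl = proj₂ (∈-filter⁻ P? {xs = downFrom N} u∈)

moves≡0 : ∀ k w {u} → moves k w u ≡ 0 → comp k w u ≡ u × (∀ {j} → j < k → w j u ≡ u)
moves≡0 zero    w _ = refl , λ ()
moves≡0 (suc k) w {u} eq with moved? (w 0) (comp k (w ∘ suc) u)
... | no ¬moved with moves≡0 k (w ∘ suc) eq | decidable-stable (w 0 (comp k (w ∘ suc) u) ≟ comp k
  (w ∘ suc) u) ¬moved
...   | V≡u , fix | w₀ = trans w₀ V≡u , λ { {zero} _ → subst (λ x → w 0 x ≡ x) V≡u w₀ ; {suc j}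
  (s≤s j<k) → fix j<k }

record SingleMove (k : ℕ) (w : ℕ → ℕ → ℕ) (u : ℕ) : Set where
  field
    i      : ℕ
    i<k    : i < k
    move   : w i u ≡ comp k w u
    -- Factors of larger index act first and still see u; those of smaller index see the final
    -- label.
    before : ∀ {j} → i < j → j < k → w j u ≡ u
    after  : ∀ {j} → j < i → w j (comp k w u) ≡ comp k w u

moves≡1 : ∀ k w {u} → moves k w u ≡ 1 → SingleMove k w u
moves≡1 (suc k) w {u} eq with moved? (w 0) (comp k (w ∘ suc) u)
... | yes _ with moves≡0 k (w ∘ suc) (suc-injective eq)
...   | V≡u , fix = record { i = 0 ; i<k = z<s ; move = cong (w 0) (sym V≡u)
        ; before = λ { {suc j} _ (s≤s j<k) → fix j<k } ; after = λ () }
moves≡1 (suc k) w {u} eq | no ¬moved = record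
  { i = suc i ; i<k = s<s i<k ; move = trans move (sym w₀)
  ; before = λ { {suc j} (s≤s i<j) (s≤s j<k) → before i<j j<k }
  ; after = λ { {zero} _ → cong (w 0) w₀ ; {suc j} (s≤s j<i) → trans (cong (w (suc j)) w₀)
    (trans (after j<i) (sym w₀)) } }
  where
  open SingleMove (moves≡1 k (w ∘ suc) eq)
  w₀ = decidable-stable (w 0 (comp k (w ∘ suc) u) ≟ comp k (w ∘ suc) u) ¬moved

-- Stands for 2 k. Its successor case reduces to `2 + double k`, which matches the insertion of two
-- labels.
double : ℕ → ℕ
double zero    = 0
double (suc k) = 2 + double k

record IsLongCycle (k : ℕ) (f : ℕ → ℕ) : Set where
  field
    step : ∀ {u} → u < double k → f u ≡ suc u
    wrap : f (double k) ≡ 0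

-- Bounds on independent sets replace the 3-cycles. Deleting two labels preserves them, by
-- `IndepBound-restrict` and `IndepBound-shrink`, and they suffice to find a removable pair. The
-- opposite direction, from codes to factorizations, builds actual 3-cycles in `Factorization3`.
record Factorization (e k : ℕ) (w : ℕ → ℕ → ℕ) : Set where
  field
    injective : ∀ {j} → j < suc e → InjectiveFun (w j)
    fixes     : ∀ {j} → j < suc e → ∀ {x} → suc (double k) ≤ x → w j x ≡ x
    product   : IsLongCycle k (comp (suc e) w)
    m         : ℕ → ℕ
    sum≤      : sumTo (suc e) m ≤ k
    bound     : ∀ {j} → j < suc e → IndepBound (w j) (m j)

-- Flattened factorizations and the count of moves

module Flattening (e : ℕ) where
  open Positions e

  -- A relation rather than a function of `w`, because a decoded code is built by insertions of
  -- positions and has to be matched with maps of labels.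
  record Flat (w : ℕ → ℕ → ℕ) (ζ : ℕ → ℕ) : Set where
    constructor mkFlat
    field
      at : ∀ {j} → j < q → ∀ u → ζ (j + u * q) ≡ j + w j u * q
  open Flat using (at)

  q+pos : ∀ i u → q + (i + u * q) ≡ i + suc u * q
  q+pos i u = trans (sym (+-assoc q i _)) (trans (cong (_+ u * q) (+-comm q i)) (+-assoc i q _))

  pos<⇒label≤ : ∀ {i j u v} → i < q → i + u * q < j + v * q → j < q → u ≤ v
  pos<⇒label≤ {i} {j} {u} {v} i<q lt j<q = ≮⇒≥ λ v<u → <⇒≱ lt (begin
    j + v * q  ≤⟨ +-monoˡ-≤ (v * q) (<⇒≤ j<q) ⟩
    q + v * q  ≤⟨ *-monoˡ-≤ q v<u ⟩
    u * q      ≤⟨ m≤n+m (u * q) i ⟩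
    i + u * q  ∎)
    where open ≤-Reasoning

  pos-injective : ∀ i {u v} → i + u * q ≡ i + v * q → u ≡ v
  pos-injective i {u} {v} eq = *-cancelʳ-≡ u v q (+-cancelˡ-≡ i _ _ eq)

  direct⇒move : ∀ {w ζ i u} → Flat w ζ → i < q → Direct ζ (i + u * q) → w i u ≡ suc u
  direct⇒move {i = i} {u} flat i<q (h , _) = pos-injective i
    (trans (sym (at flat i<q u)) (trans h (q+pos i u)))

  -- Strictly between i + u q and i + (u + 1) q lie only label u in the factors j > i, which act
  -- before the move, and label u + 1 in the factors j < i, which act after it.
  singleMove⇒direct : ∀ {w ζ u} → Flat w ζ → comp q w u ≡ suc u → (σ : SingleMove q w u) →
    Direct ζ (SingleMove.i σ + u * q)
  singleMove⇒direct {w} {ζ} {u} flat c≡ σ =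
    trans (at flat i<k u) (trans (cong (λ x → i + x * q) (trans move c≡)) (sym (q+pos i u))) , fix
    where
    open SingleMove σ
    label-fix : ∀ j x → j < q → i + u * q < j + x * q → j + x * q < i + suc u * q → w j x ≡ x
    label-fix j x j<q lo hi with m≤n⇒m<n∨m≡n (pos<⇒label≤ {u = u} {x} i<k lo j<q)
    ... | inj₂ refl = before (+-cancelʳ-< (u * q) i j lo) j<q
    ... | inj₁ u<x  with ≤-antisym (pos<⇒label≤ {u = x} {suc u} j<q hi i<k) u<x
    ...   | refl = subst (λ y → w j y ≡ y) c≡ (after (+-cancelʳ-< (suc u * q) j i hi))
    fix : ∀ p → i + u * q < p → p < q + (i + u * q) → ζ p ≡ p
    fix p lo hi = subst (λ p → ζ p ≡ p) (sym p≡) (trans (at flat j<q (p / q)) (cong (λ y → p % q + y * q)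
      (label-fix (p % q) (p / q) j<q (subst (i + u * q <_) p≡ lo) (subst₂ _<_ p≡ (q+pos i u) hi))))
      where
      j<q = m%n<n p q
      p≡ : p ≡ p % q + p / q * q
      p≡ = m≡m%n+[m/n]*n p q

  module _ {k w ζ} (F : Factorization e (suc k) w) (flat : Flat w ζ) where
    open Factorization F
    open IsLongCycle product

    private
      K = double (suc k)
      δ : ℕ → ℕ → ℕ
      δ u i = indicator (direct? ζ (i + u * q))

    -- The long cycle moves u, so its path has at least one move. If it has exactly one, that move
    -- is a direct step, which supplies the second unit.
    row : ∀ {u} → u < K → 2 ≤ moves q w u + sumTo q (δ u)
    row {u} u<K with moves q w u in eq
    ... | 0 = contradiction (trans (sym (step u<K)) (proj₁ (moves≡0 q w eq))) (≢-sym (m≢1+n+m u {0}))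
    ... | 1 = s≤s (≤-trans (≤-reflexive (sym (indicator-yes (direct? ζ _)
      (singleMove⇒direct flat (step u<K) σ))))
                (sumTo-term q (δ u) (SingleMove.i<k σ)))
      where σ = moves≡1 q w eq
    ... | suc (suc n) = s≤s (s≤s z≤n)

    last-row : 1 ≤ moves q w K
    last-row with moves q w K in eq
    ... | 0     = contradiction (trans (sym wrap) (proj₁ (moves≡0 q w eq))) λ ()
    ... | suc _ = s≤s z≤n

    -- Factor i sends a label u with a direct step to u + 1, and two consecutive direct steps would
    -- form a removable pair. So the labels with a direct step in factor i are independent for it.
    column : (¬ ∃ λ u → u < suc (double k) × ∃ λ i → i < q × Removable ζ (i + u * q)) →
      ∀ {i} → i < q → sumTo K (λ u → δ u i) ≤ m i
    column none {i} i<q = subst (_≤ m i) (sym (sumTo-indicator K P?))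
      (bound i<q (Unique.filter⁺ P? (Unique.downFrom⁺ K)) indep)
      where
      P? = λ u → direct? ζ (i + u * q)
      indep : Independent (w i) (filter P? (downFrom K))
      indep {u} u∈ wu∈ with ∈-filter⁻ P? {xs = downFrom K} u∈ | ∈-filter⁻ P? {xs = downFrom K} wu∈
      ... | u∈K , d₀ | wu∈K , d₁ rewrite direct⇒move {u = u} flat i<q d₀ =
        none (u , s<s⁻¹ (∈-downFrom⁻ wu∈K) , i , i<q , d₀ , subst (Direct ζ) (sym (q+pos i u)) d₁)

    exists-removable : ∃ λ u → u < suc (double k) × ∃ λ i → i < q × Removable ζ (i + u * q)
    exists-removable with anyUpTo? (λ u → anyUpTo? (λ i → removable? ζ (i + u * q)) q) (suc (double k))
    ... | yes h    = h
    ... | no  none = contradiction counting (<-irrefl refl)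
      where
      open ≤-Reasoning
      M = sumTo q m
      2*K : K * 2 ≤ sumTo K (moves q w) + M
      2*K = begin
        K * 2                                              ≡⟨ sumTo-const K 2 ⟨
        sumTo K (λ _ → 2)                                  ≤⟨ sumTo-mono K row ⟩
        sumTo K (λ u → moves q w u + sumTo q (δ u))        ≡⟨ sumTo-+ K (moves q w) _ ⟩
        sumTo K (moves q w) + sumTo K (λ u → sumTo q (δ u))
          ≡⟨ cong (sumTo K (moves q w) +_) (sumTo-swap K q δ) ⟩
        sumTo K (moves q w) + sumTo q (λ i → sumTo K (λ u → δ u i))
          ≤⟨ +-monoʳ-≤ (sumTo K (moves q w)) (sumTo-mono q (column none)) ⟩
        sumTo K (moves q w) + M                            ∎
      double≡ : ∀ k → double k ≡ k * 2
      double≡ zero    = refl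
      double≡ (suc k) = cong (2 +_) (double≡ k)
      -- The labels below K account for at least 2K moves and direct steps, label K for one more
      -- move. Yet there are at most 3M moves and M direct steps, and 4M ≤ 4 (k + 1) = 2K.
      counting : K * 2 < K * 2
      counting = begin-strict
        K * 2                              <⟨ n<1+n (K * 2) ⟩
        1 + K * 2                          ≤⟨ +-mono-≤ last-row 2*K ⟩
        moves q w K + (sumTo K (moves q w) + M)   ≡⟨ +-assoc (moves q w K) _ M ⟨
        sumTo (suc K) (moves q w) + M      ≤⟨ +-monoˡ-≤ M (moves-bound (suc K) q injective bound) ⟩
        3 * M + M                          ≡⟨ +-comm (3 * M) M ⟩
        4 * M                              ≤⟨ *-monoʳ-≤ 4 sum≤ ⟩
        4 * suc k                          ≡⟨ *-comm 4 (suc k) ⟩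
        suc k * 4                          ≡⟨ *-assoc (suc k) 2 2 ⟨
        suc k * 2 * 2                      ≡⟨ cong (_* 2) (double≡ (suc k)) ⟨
        K * 2                              ∎

-- Codes against factorizations

sumTo-bump : ∀ n {i} {m m′ : ℕ → ℕ} → i < n → m′ i ≡ suc (m i) → (∀ {j} → j ≢ i → m′ j ≡ m j) →
  sumTo n m′ ≡ suc (sumTo n m)
sumTo-bump (suc n) {i} {m} {m′} i<1+n at-i else-j with m<1+n⇒m<n∨m≡n i<1+n
... | inj₂ refl = cong₂ _+_ at-i (sumTo-cong n (λ j<n → else-j (<⇒≢ j<n)))
... | inj₁ i<n  = trans (cong₂ _+_ (else-j (≢-sym (<⇒≢ i<n))) (sumTo-bump n i<n at-i else-j)) (+-suc (m n) _)

IsLongCycle-restrict : ∀ {k u f g} → u ≤ double k → Extends u (suc u) f g → IsLongCycle (suc k) f →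
  IsLongCycle k g
IsLongCycle-restrict {k} {u} {f} {g} u≤ ε L = record { step = step′ ; wrap = wrap′ }
  where
  open IsLongCycle L
  open Extends ε
  step′ : ∀ {x} → x < double k → g x ≡ suc x
  step′ {x} x< with x <? u
  ... | yes x<u = shift-injective 2 (suc u) (trans (sym (old x)) (trans (cong f (shift-< 2 x<u))
                    (trans (step (m<n⇒m<1+n (m<n⇒m<1+n x<))) (sym (shift-< 2 (s<s x<u))))))
  ... | no  x≮u = shift-injective 2 (suc u) (trans (sym (old x)) (trans (cong f (shift-≥ 2 (≮⇒≥ x≮u)))
                    (trans (step (s<s (s<s x<))) (sym (shift-≥ 2 (s≤s (≮⇒≥ x≮u)))))))
  wrap′ : g (double k) ≡ 0
  -- As u is at most the last label, the shift sends the last label to the last label; the image 0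
  -- lies below the gap at u + 1.
  wrap′ = shift-injective 2 (suc u) (trans (sym (old _))
    (trans (cong f (shift-≥ 2 u≤)) (trans wrap (sym (shift-< 2 {suc u} {0} z<s)))))

IsLongCycle-extend : ∀ {k u f g} → u ≤ double k → Extends u (suc u) f g → IsLongCycle k g → IsLongCycle
  (suc k) f
IsLongCycle-extend {k} {u} {f} {g} u≤ ε L = record { step = step′ ; wrap = wrap′ }
  where
  open IsLongCycle L
  open Extends ε
  step′ : ∀ {y} → y < double (suc k) → f y ≡ suc y
  step′ {y} y< with label-cover u y
  ... | inj₂ (inj₁ refl) = at₀
  ... | inj₂ (inj₂ refl) = at₁
  ... | inj₁ (x , refl) with x <? u
  ...   | yes x<u = trans (trans (cong f (sym (shift-< 2 x<u))) (old x))
    (trans (cong (shift 2 (suc u)) (step (<-≤-trans x<u u≤))) (shift-< 2 (s<s x<u)))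
  ...   | no  x≮u = trans (trans (cong f (sym (shift-≥ 2 (≮⇒≥ x≮u)))) (old x))
    (trans (cong (shift 2 (suc u)) (step (s<s⁻¹ (s<s⁻¹ y<)))) (shift-≥ 2 (s≤s (≮⇒≥ x≮u))))
  wrap′ : f (double (suc k)) ≡ 0
  wrap′ = trans (cong f (sym (shift-≥ 2 u≤))) (trans (old _) (trans (cong (shift 2 (suc u)) wrap)
    (shift-< 2 {suc u} z<s)))

-- Inserting two labels at colour i after label u: colours j ≤ i see the old label u
-- before the new ones, colours j > i see it after them.
threshold : ℕ → ℕ → ℕ → ℕ
threshold i u j with j ≤? i
... | yes _ = suc u
... | no  _ = u

threshold-≤ : ∀ {i j} u → j ≤ i → threshold i u j ≡ suc u
threshold-≤ {i} {j} u j≤i with j ≤? i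
... | yes _ = refl
... | no  h = contradiction j≤i h

threshold-> : ∀ {i j} u → i < j → threshold i u j ≡ u
threshold-> {i} {j} u i<j with j ≤? i
... | yes h = contradiction h (<⇒≱ i<j)
... | no  _ = refl

-- Only factor i has different gaps in domain and codomain; every other factor just gains two fixed
-- labels.
threshold-const : ∀ {i j} u → j ≢ i → threshold i u j ≡ threshold i u (suc j)
threshold-const {i} {j} u j≢i with <-cmp j i
... | tri< j<i _ _ = trans (threshold-≤ u (<⇒≤ j<i)) (sym (threshold-≤ u j<i))
... | tri≈ _ j≡i _ = contradiction j≡i j≢i
... | tri> _ _ i<j = trans (threshold-> u i<j) (sym (threshold-> u (m<n⇒m<1+n i<j)))

threshold-bound : ∀ i {u N} j → u < N → threshold i u j ≤ N
threshold-bound i j u<N with j ≤? i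
... | yes _ = u<N
... | no  _ = <⇒≤ u<N

Extends-threshold : ∀ i u {f g} → Extends (threshold i u (suc i)) (threshold i u i) f g → Extends u
  (suc u) f g
Extends-threshold i u ε = subst₂ (λ a b → Extends a b _ _) (threshold-> u ≤-refl) (threshold-≤ {i} u ≤-refl) ε

Extends-product : ∀ {i k f g} → i < k → ∀ u → Extends (threshold i u k) (threshold i u 0) f g →
  Extends u (suc u) f g
Extends-product {i} {f = f} {g} i<k u ε = subst₂ (λ a b → Extends a b f g) (threshold-> u i<k)
  (threshold-≤ {i} u z≤n) ε

module Transfer (e : ℕ) where
  open Positions e
  open Codes e
  open Flattening e
  open Flat using (at)

  flatten : (ℕ → ℕ → ℕ) → ℕ → ℕ
  flatten w p = p % q + w (p % q) (p / q) * q

  [pos]%q : ∀ {j} u → j < q → (j + u * q) % q ≡ j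
  [pos]%q {j} u j<q = trans ([m+kn]%n≡m%n j u q) (m<n⇒m%n≡m j<q)

  [pos]/q : ∀ {j} u → j < q → (j + u * q) / q ≡ u
  [pos]/q {j} u j<q = trans (+-distrib-/-∣ʳ j (n∣m*n u)) (cong₂ _+_ (m<n⇒m/n≡0 j<q) (m*n/n≡m u q))

  flatten-flat : ∀ w → Flat w (flatten w)
  flatten-flat w = mkFlat λ j<q u → cong₂ (λ a b → a + w a b * q) ([pos]%q u j<q) ([pos]/q u j<q)

  Flat-cong : ∀ {w ζ ξ} → (∀ p → ζ p ≡ ξ p) → Flat w ζ → Flat w ξ
  Flat-cong ζ≗ξ flat = mkFlat λ j<q u → trans (sym (ζ≗ξ _)) (at flat j<q u)

  pos : ∀ p → p ≡ p % q + p / q * q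
  pos p = m≡m%n+[m/n]*n p q

  flat-fixed : ∀ {w ζ} → Flat w ζ → ∀ {j} → j < q → ∀ {u} → ζ (j + u * q) ≡ j + u * q → w j u ≡ u
  flat-fixed flat {j} j<q h = pos-injective j (trans (sym (at flat j<q _)) h)

  module _ {i} (i<q : i < q) (u : ℕ) where
    private
      s = i + u * q
      τ = threshold i u

    row-< : ∀ {j} x {y} → j < q → x < y → j + x * q < y * q
    row-< x j<q x<y = <-≤-trans (+-monoˡ-< (x * q) j<q) (*-monoˡ-≤ q x<y)

    shift-pos : ∀ t {T} j x → (x < t → j + x * q < T) → (t ≤ x → T ≤ j + x * q) →
      shift D T (j + x * q) ≡ j + shift 2 t x * q
    shift-pos t j x lt ge with x <? t
    ... | yes x<t = shift-< D (lt x<t)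
    ... | no  x≮t = trans (shift-≥ D (ge (≮⇒≥ x≮t))) (begin
      D + (j + x * q)       ≡⟨ +-assoc q q _ ⟩
      q + (q + (j + x * q)) ≡⟨ cong (q +_) (q+pos j x) ⟩
      q + (j + suc x * q)   ≡⟨ q+pos j (suc x) ⟩
      j + (2 + x) * q       ∎)
      where open ≡-Reasoning

    -- Position j + x q precedes s exactly when x < u, or x = u and j < i, so in factor j the gap of
    -- labels starts at the threshold of j + 1. For images the gap starts at s + 1, so j = i counts
    -- too; this gives the threshold of j in `shift-pos-target`.
    shift-pos-source : ∀ {j} x → j < q → shift D s (j + x * q) ≡ j + shift 2 (τ (suc j)) x * q
    shift-pos-source {j} x j<q with suc j ≤? i
    ... | yes j<i = shift-pos (suc u) j x
            (λ x<1+u → +-mono-<-≤ j<i (*-monoˡ-≤ q (s≤s⁻¹ x<1+u)))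
            (λ u<x → ≤-trans (<⇒≤ (row-< u i<q u<x)) (m≤n+m (x * q) j))
    ... | no  j≮i = shift-pos u j x
            (λ x<u → <-≤-trans (row-< x j<q x<u) (m≤n+m (u * q) i))
            (λ u≤x → +-mono-≤ (≮⇒≥ j≮i) (*-monoˡ-≤ q u≤x))

    shift-pos-target : ∀ {j} x → j < q → shift D (suc s) (j + x * q) ≡ j + shift 2 (τ j) x * q
    shift-pos-target {j} x j<q with j ≤? i
    ... | yes j≤i = shift-pos (suc u) j x
            (λ x<1+u → s≤s (+-mono-≤ j≤i (*-monoˡ-≤ q (s≤s⁻¹ x<1+u))))
            (λ u<x → ≤-trans (row-< u i<q u<x) (m≤n+m (x * q) j))
    ... | no  j≰i = shift-pos u j x
            (λ x<u → s≤s (≤-trans (<⇒≤ (row-< x j<q x<u)) (m≤n+m (u * q) i)))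
            (λ u≤x → +-mono-<-≤ (≰⇒> j≰i) (*-monoˡ-≤ q u≤x))

    -- The 2q positions of the gap are the two new labels of each factor. For j ≠ i they are fixed
    -- by `threshold-const`; for j = i they sit at s and q + s and carry the two steps of the pair.
    extends⇒insertion : ∀ {w w′ ζ ζ′} → Flat w ζ → Flat w′ ζ′ →
      (∀ {j} → j < q → Extends (τ (suc j)) (τ j) (w′ j) (w j)) → Insertion s ζ ζ′
    extends⇒insertion {w} {w′} {ζ} {ζ′} flat flat′ ε = record
      { old   = λ p → subst (λ p → ζ′ (shift D s p) ≡ shift D (suc s) (ζ p)) (sym (pos p))
        (old′ (p / q) (m%n<n p q))
      ; new₀  = trans (at flat′ i<q u) (trans (cong (λ x → i + x * q) E.at₀) (sym (q+pos i u)))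
      ; new₁  = trans (cong ζ′ (q+pos i u)) (trans (at flat′ i<q (suc u))
        (trans (cong (λ x → i + x * q) E.at₁)
                  (sym (trans (+-assoc q q s) (trans (cong (q +_) (q+pos i u)) (q+pos i (suc u)))))))
      ; fixed = fixed′ }
      where
      module E = Extends (Extends-threshold i u (ε i<q))
      old′ : ∀ {j} x → j < q → ζ′ (shift D s (j + x * q)) ≡ shift D (suc s) (ζ (j + x * q))
      old′ {j} x j<q = begin
        ζ′ (shift D s (j + x * q))               ≡⟨ cong ζ′ (shift-pos-source x j<q) ⟩
        ζ′ (j + shift 2 (τ (suc j)) x * q)       ≡⟨ at flat′ j<q _ ⟩
        j + w′ j (shift 2 (τ (suc j)) x) * q     ≡⟨ cong (λ y → j + y * q) (Extends.old (ε j<q) x) ⟩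
        j + shift 2 (τ j) (w j x) * q            ≡⟨ shift-pos-target (w j x) j<q ⟨
        shift D (suc s) (j + w j x * q)          ≡⟨ cong (shift D (suc s)) (at flat j<q x) ⟨
        shift D (suc s) (ζ (j + x * q))          ∎
        where open ≡-Reasoning
      label-fix : ∀ {j} x → j < q → s < j + x * q → j + x * q < D + s → j + x * q ≢ q + s → w′ j x ≡ x
      label-fix {j} x j<q lo hi ≢q+s with label-cover (τ (suc j)) x
      ... | inj₁ (y , refl) = contradiction (subst (_< D + s) (sym (shift-pos-source y j<q)) hi)
              (shift-misses D s (j + y * q) (subst (s ≤_) (sym (shift-pos-source y j<q)) (<⇒≤ lo)))
      ... | inj₂ new with j ≟ i
      label-fix {j} x j<q lo hi ≢q+s | inj₂ (inj₁ refl) | no j≢i = trans (Extends.at₀ (ε j<q))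
        (threshold-const u j≢i)
      label-fix {j} x j<q lo hi ≢q+s | inj₂ (inj₂ refl) | no j≢i = trans (Extends.at₁ (ε j<q))
        (cong suc (threshold-const u j≢i))
      label-fix {j} x j<q lo hi ≢q+s | inj₂ (inj₁ refl) | yes refl =
        contradiction (cong (λ x → i + x * q) (sym (threshold-> {i} u ≤-refl))) (<⇒≢ lo)
      label-fix {j} x j<q lo hi ≢q+s | inj₂ (inj₂ refl) | yes refl =
        contradiction (trans (cong (λ x → i + suc x * q) (threshold-> {i} u ≤-refl)) (sym (q+pos i u))) ≢q+s
      fixed′ : ∀ p → s < p → p < D + s → p ≢ q + s → ζ′ p ≡ p
      fixed′ p lo hi ≢q+s = subst (λ p → ζ′ p ≡ p) (sym (pos p)) (trans (at flat′ (m%n<n p q) (p / q))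
        (cong (λ y → p % q + y * q)
        (label-fix (p / q) (m%n<n p q) (subst (s <_) (pos p) lo) (subst (_< D + s) (pos p) hi)
          (subst (_≢ q + s) (pos p) ≢q+s))))

    -- For j ≠ i one label of factor j lies strictly between s and q + s and the next one between q
    -- + s and 2q + s, where `ζ` fixes everything. For j = i the two labels are the starting points
    -- of the direct steps.
    removable⇒new : ∀ {w ζ} → Flat w ζ → Removable ζ s → ∀ {j} → j < q →
      w j (τ (suc j)) ≡ τ j × w j (suc (τ (suc j))) ≡ suc (τ j)
    removable⇒new {w} {ζ} flat ((d₀ , f₀) , d₁@(_ , f₁)) {j} j<q with <-cmp j i
    ... | tri≈ _ refl _ rewrite threshold-≤ {i} u ≤-refl | threshold-> {i} u ≤-refl =
      direct⇒move {u = u} flat i<q (d₀ , f₀) ,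
      direct⇒move {u = suc u} flat i<q (subst (Direct ζ) (q+pos i u) d₁)
    ... | tri< j<i _ _ rewrite threshold-≤ {i} u (<⇒≤ j<i) | threshold-≤ {i} u j<i =
      flat-fixed flat j<q (f₀ _ (≤-trans (row-< u i<q ≤-refl) (m≤n+m _ j))
        (subst (j + suc u * q <_) (sym (q+pos i u)) (+-monoˡ-< _ j<i))) ,
      flat-fixed flat j<q (f₁ _ (subst (_< j + (2 + u) * q) (sym (q+pos i u))
        (≤-trans (row-< (suc u) i<q ≤-refl) (m≤n+m _ j)))
        (subst (j + (2 + u) * q <_) (sym (trans (cong (q +_) (q+pos i u)) (q+pos i (suc u))))
          (+-monoˡ-< _ j<i)))
    ... | tri> _ _ i<j rewrite threshold-> u i<j | threshold-> u (m<n⇒m<1+n i<j) =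
      flat-fixed flat j<q (f₀ _ (+-monoˡ-< (u * q) i<j) (subst (j + u * q <_) (sym (q+pos i u))
        (<-≤-trans (row-< u j<q ≤-refl) (m≤n+m _ i)))) ,
      flat-fixed flat j<q (f₁ _ (subst (_< j + suc u * q) (sym (q+pos i u)) (+-monoˡ-< (suc u * q) i<j))
        (subst (j + suc u * q <_) (sym (trans (cong (q +_) (q+pos i u)) (q+pos i (suc u))))
          (<-≤-trans (row-< (suc u) j<q ≤-refl) (m≤n+m _ i))))

    remove-pair : ∀ {k w ζ} → Factorization e (suc k) w → Flat w ζ → Removable ζ s → u < suc (double k) →
      ∃ λ w₀ → Factorization e k w₀ × (∀ {j} → j < q → Extends (τ (suc j)) (τ j) (w j) (w₀ j))
    remove-pair {k} {w} {ζ} F flat rem u<N = w₀ , F₀ , ε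
      where
      open Factorization F
      restricted : ∀ {j} → j < q → ∃ (Extends (τ (suc j)) (τ j) (w j))
      restricted j<q = let (h₀ , h₁) = removable⇒new flat rem j<q in restrict (injective j<q) h₀ h₁
      w₀ : ℕ → ℕ → ℕ
      w₀ j with j <? q
      ... | yes j<q = proj₁ (restricted j<q)
      ... | no  _   = λ x → x
      ε : ∀ {j} → j < q → Extends (τ (suc j)) (τ j) (w j) (w₀ j)
      ε {j} j<q with j <? q
      ... | yes j<q′ = proj₂ (restricted j<q′)
      ... | no  j≮q  = contradiction j<q j≮q
      εᵢ : Extends u (suc u) (w i) (w₀ i)
      εᵢ = Extends-threshold i u (ε i<q)
      shrink : ∀ {S} → Unique S → Independent (w₀ i) S → suc (length S) ≤ m i
      shrink = IndepBound-shrink (injective i<q) εᵢ (bound i<q)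
      m₀ : ℕ → ℕ
      m₀ j with j ≟ i
      ... | yes _ = pred (m j)
      ... | no  _ = m j
      m₀-i : m i ≡ suc (m₀ i)
      m₀-i with i ≟ i
      -- `shrink` applied to the empty set gives m i ≥ 1, so the predecessor is a true decrease.
      ... | yes _  = sym (suc-pred (m i) ⦃ >-nonZero (shrink [] λ ()) ⦄)
      ... | no  h = contradiction refl h
      m₀-j : ∀ {j} → j ≢ i → m j ≡ m₀ j
      m₀-j {j} j≢i with j ≟ i
      ... | yes h = contradiction h j≢i
      ... | no  _ = refl
      bound₀ : ∀ {j} → j < q → IndepBound (w₀ j) (m₀ j)
      bound₀ {j} j<q with j ≟ i
      ... | yes refl = λ uS iS → <⇒≤pred (shrink uS iS)
      ... | no  j≢i  = IndepBound-restrict (subst (λ t → Extends (τ (suc j)) t (w j) (w₀ j))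
        (threshold-const u j≢i) (ε j<q)) (bound j<q)
      F₀ : Factorization e k w₀
      F₀ = record
        { injective = λ j<q → restriction-injective (ε j<q) (injective j<q)
        ; fixes     = λ {j} j<q → restriction-fixed (ε j<q) (threshold-bound i (suc j) u<N)
          (threshold-bound i j u<N) (fixes j<q)
        ; product   = IsLongCycle-restrict (s≤s⁻¹ u<N)
                        (Extends-product i<q u (comp-extends q τ ε)) product
        ; m         = m₀
        ; sum≤      = s≤s⁻¹ (subst (_≤ suc k) (sumTo-bump q i<q m₀-i m₀-j) sum≤)
        ; bound     = bound₀ }

  -- Factor i sends u + 1 to u + 2. If u + 2 were beyond the labels it would be fixed as well,
  -- against injectivity.
  removable⇒label< : ∀ {k w ζ i u} → Factorization e (suc k) w → Flat w ζ → i < q → Removable ζ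
    (i + u * q) → u < suc (double k)
  removable⇒label< {k} {w} {ζ} {i} {u} F flat i<q (_ , d₁) = s<s⁻¹ (s<s⁻¹ (≰⇒> λ N≤2+u →
    m≢1+n+m (suc u) {0} (injective i<q (trans moved (sym (fixes i<q N≤2+u))))))
    where
    open Factorization F
    moved : w i (suc u) ≡ 2 + u
    moved = direct⇒move {u = suc u} flat i<q (subst (Direct ζ) (q+pos i u) d₁)

  size≡ : ∀ k → size k ≡ suc (double k) * q
  size≡ zero    = sym (+-identityʳ q)
  size≡ (suc k) = trans (cong (D +_) (size≡ k)) (+-assoc q q _)

  pos<size : ∀ k {i} u → i < q → u < suc (double k) → i + u * q < size k
  pos<size k {i} u i<q u<N = subst (i + u * q <_) (sym (size≡ k)) (<-≤-trans (+-monoˡ-< (u * q) i<q)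
    (*-monoˡ-≤ q u<N))

  -- Delete the last removable pair, encode the smaller factorization, and insert the pair again.
  -- Since the pair was last, its position is allowed and hence a slot. With a single label every
  -- factor is the identity.
  decode-surjective : ∀ k {w} → Factorization e k w → ∃ λ c → Valid k c × Flat w (decode c)
  decode-surjective zero {w} F = [] , [] , mkFlat λ {j} j<q u → cong (λ x → j + x * q) (sym (identity j<q u))
    where
    open Factorization F
    identity : ∀ {j} → j < q → ∀ u → w j u ≡ u
    identity j<q (suc u) = fixes j<q (s≤s z≤n)
    identity {j} j<q zero with w j 0 in eq
    ... | zero  = refl
    ... | suc y = contradiction (injective j<q (trans eq (sym (fixes j<q {suc y} (s≤s z≤n))))) λ ()
  decode-surjective (suc k) {w} F
    with exists-removable F (flatten-flat w)
  ... | u₀ , u₀<N , i₀ , i₀<q , rem₀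
    with max-witness (removable? (flatten w)) (size k) (i₀ + u₀ * q , pos<size k u₀ i₀<q u₀<N , rem₀)
  ... | s , s<size , rem , last
    with remove-pair (m%n<n s q) (s / q) F (flatten-flat w) (subst (Removable (flatten w)) (pos s) rem)
           (removable⇒label< F (flatten-flat w) (m%n<n s q) (subst (Removable (flatten w)) (pos s) rem))
  ... | w₀ , F₀ , ε
    with decode-surjective k F₀
  ... | c , valid , flat = s ∷ c , slots-complete valid s<size (last⇒allowed ι last′) ∷ valid ,
        Flat-cong (insertion-unique (λ _ → refl) ι (insert-insertion (decode c) s)) (flatten-flat w)
    where
    ι : Insertion s (decode c) (flatten w)
    ι = subst (λ s → Insertion s (decode c) (flatten w)) (sym (pos s))
          (extends⇒insertion (m%n<n s q) (s / q) flat (flatten-flat w) ε)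
    -- The search for s covers only the positions below `size k`; by `removable⇒label<` no removable
    -- position lies beyond them.
    last′ : ∀ t → s < t → ¬ Removable (flatten w) t
    last′ t s<t rem-t = last t s<t (subst (_< size k) (sym (pos t)) (pos<size k (t / q) (m%n<n t q)
      (removable⇒label< F (flatten-flat w) (m%n<n t q) rem-t′))) rem-t
      where rem-t′ = subst (Removable (flatten w)) (pos t) rem-t

  record Factorization3 (k : ℕ) (w : ℕ → ℕ → ℕ) : Set where
    field
      product : IsLongCycle k (comp q w)
      m       : ℕ → ℕ
      sum≡    : sumTo q m ≡ k
      prod3   : ∀ {j} → j < q → Prod3 (suc (double k)) (m j) (w j)

  Factorization3-base : Factorization3 0 (λ _ x → x)
  Factorization3-base = record
    { product = record { step = λ () ; wrap = comp-id q }
    ; m = λ _ → 0 ; sum≡ = trans (sumTo-const q 0) (*-zeroʳ q) ; prod3 = λ _ → nil λ _ → refl }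
    where
    comp-id : ∀ k → comp k (λ _ x → x) 0 ≡ 0
    comp-id zero    = refl
    comp-id (suc k) = comp-id k

  insert-pair : ∀ {i u k w} → i < q → u < suc (double k) → Factorization3 k w →
    Factorization3 (suc k) (λ j → extend (threshold i u (suc j)) (threshold i u j) (w j))
  insert-pair {i} {u} {k} {w} i<q u<N F = record
    { product = IsLongCycle-extend (s≤s⁻¹ u<N)
        (Extends-product i<q u (comp-extends q τ (λ {j} _ → ε j))) product
    ; m = m′ ; sum≡ = trans (sumTo-bump q i<q m′-i m′-j) (cong suc sum≡) ; prod3 = prod3′ }
    where
    open Factorization3 F
    τ = threshold i u
    ε : ∀ j → Extends (τ (suc j)) (τ j) (extend (τ (suc j)) (τ j) (w j)) (w j)
    ε j = extend-extends (τ (suc j)) (τ j) (w j)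
    m′ : ℕ → ℕ
    m′ j with j ≟ i
    ... | yes _ = suc (m j)
    ... | no  _ = m j
    m′-i : m′ i ≡ suc (m i)
    m′-i with i ≟ i
    ... | yes _ = refl
    ... | no  h = contradiction refl h
    m′-j : ∀ {j} → j ≢ i → m′ j ≡ m j
    m′-j {j} j≢i with j ≟ i
    ... | yes h = contradiction h j≢i
    ... | no  _ = refl
    prod3′ : ∀ {j} → j < q → Prod3 (3 + double k) (m′ j) (extend (τ (suc j)) (τ j) (w j))
    prod3′ {j} j<q with j ≟ i
    ... | yes refl = Prod3-grow u<N (Extends-threshold i u (ε i)) (prod3 i<q)
    ... | no  j≢i  = Prod3-extend (subst (λ t → Extends (τ (suc j)) t (extend (τ (suc j)) (τ j) (w j))
      (w j)) (threshold-const u j≢i) (ε j)) (prod3 j<q)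

  -- `slots-sound` keeps s below `size k`, so s / q is an existing label, and the pair costs one
  -- more 3-cycle in factor s % q.
  decode-sound : ∀ {k c} → Valid k c → ∃ λ w → Factorization3 k w × Flat w (decode c)
  decode-sound [] = _ , Factorization3-base , mkFlat λ _ _ → refl
  decode-sound {suc k} {s ∷ c} (s∈ ∷ valid) with decode-sound valid
  ... | w , F , flat = w′ , insert-pair (m%n<n s q) u<N F ,
        Flat-cong (insertion-unique (λ _ → refl) ι (insert-insertion (decode c) s)) (flatten-flat w′)
    where
    u<N : s / q < suc (double k)
    u<N = m<n*o⇒m/o<n (subst (s <_) (size≡ k) (proj₁ (slots-sound valid s∈)))
    τ = threshold (s % q) (s / q)
    w′ : ℕ → ℕ → ℕ
    w′ j = extend (τ (suc j)) (τ j) (w j)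
    ι : Insertion s (decode c) (flatten w′)
    ι = subst (λ s → Insertion s (decode c) (flatten w′)) (sym (pos s))
          (extends⇒insertion (m%n<n s q) (s / q) flat (flatten-flat w′)
            (λ {j} _ → extend-extends (τ (suc j)) (τ j) (w j)))

-- Permutations in one-line notation as functions on labels

toFun : ∀ {N} → Perm N → ℕ → ℕ
toFun {N} x u with u <? N
... | yes u<N = toℕ (lookup x (fromℕ< u<N))
... | no  _   = u

toFun-toℕ : ∀ {N} (x : Perm N) i → toFun x (toℕ i) ≡ toℕ (lookup x i)
toFun-toℕ {N} x i with toℕ i <? N
... | yes i<N = cong (toℕ ∘ lookup x) (fromℕ<-toℕ i i<N)
... | no  i≮N = contradiction (toℕ<n i) i≮N

toFun-≥ : ∀ {N} (x : Perm N) {u} → N ≤ u → toFun x u ≡ u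
toFun-≥ {N} x {u} N≤u with u <? N
... | yes u<N = contradiction N≤u (<⇒≱ u<N)
... | no  _   = refl

Fin-≗ : ∀ {N} {f g : ℕ → ℕ} → (∀ (i : Fin N) → f (toℕ i) ≡ g (toℕ i)) → (∀ {u} → N ≤ u → f u ≡ g u) →
  ∀ u → f u ≡ g u
Fin-≗ {N} {f} {g} lo hi u with u <? N
... | yes u<N = subst (λ u → f u ≡ g u) (toℕ-fromℕ< u<N) (lo (fromℕ< u<N))
... | no  u≮N = hi (≮⇒≥ u≮N)

toFun-injective : ∀ {N} {x y : Perm N} → (∀ u → toFun x u ≡ toFun y u) → x ≡ y
toFun-injective {x = x} {y} h = trans (sym (tabulate∘lookup x)) (trans (tabulate-cong λ i →
  toℕ-injective (trans (sym (toFun-toℕ x i)) (trans (h (toℕ i)) (toFun-toℕ y i)))) (tabulate∘lookup y))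

toFun-· : ∀ {N} (x y : Perm N) u → toFun (x · y) u ≡ toFun x (toFun y u)
toFun-· x y = Fin-≗
  (λ i → trans (toFun-toℕ (x · y) i) (trans (cong toℕ (lookup∘tabulate _ i))
    (sym (trans (cong (toFun x) (toFun-toℕ y i)) (toFun-toℕ x (lookup y i))))))
  (λ N≤u → trans (toFun-≥ (x · y) N≤u) (sym (trans (cong (toFun x) (toFun-≥ y N≤u)) (toFun-≥ x N≤u))))

toFun-ident : ∀ N u → toFun (ident {N}) u ≡ u
toFun-ident N = Fin-≗ {N} (λ i → trans (toFun-toℕ ident i) (cong toℕ (lookup∘tabulate (λ i → i) i)))
  (toFun-≥ (ident {N}))

toFun-threeCycle : ∀ {N} (t : Triple N) u →
  toFun (threeCycle t) u ≡ cycle3 (toℕ (Triple.a t)) (toℕ (Triple.b t)) (toℕ (Triple.d t)) u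
toFun-threeCycle {N} t@(triple a b d a≢b b≢d a≢d) = Fin-≗ on-Fin
  (λ N≤u → trans (toFun-≥ (threeCycle t) N≤u) (sym (cycle3-fixed a≢b′ b≢d′ a≢d′ (ne N≤u a) (ne N≤u b)
    (ne N≤u d))))
  where
  a≢b′ = a≢b ∘ toℕ-injective
  b≢d′ = b≢d ∘ toℕ-injective
  a≢d′ = a≢d ∘ toℕ-injective
  ne : ∀ {u} → N ≤ u → (i : Fin N) → u ≢ toℕ i
  ne N≤u i refl = <⇒≱ (toℕ<n i) N≤u
  on-Fin : ∀ i → toFun (threeCycle t) (toℕ i) ≡ cycle3 (toℕ a) (toℕ b) (toℕ d) (toℕ i)
  on-Fin i = trans (toFun-toℕ (threeCycle t) i) (trans (cong toℕ (lookup∘tabulate _ i)) (cases i))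
    where
    cases : ∀ i → toℕ (if does (i Fin.≟ a) then b else
      (if does (i Fin.≟ b) then d else (if does (i Fin.≟ d) then a else i)))
      ≡ cycle3 (toℕ a) (toℕ b) (toℕ d) (toℕ i)
    cases i with i Fin.≟ a | i Fin.≟ b | i Fin.≟ d
    ... | yes refl | _ | _ = sym (cycle3-a a≢b′ b≢d′ a≢d′)
    ... | no _ | yes refl | _ = sym (cycle3-b a≢b′ b≢d′ a≢d′)
    ... | no _ | no _ | yes refl = sym (cycle3-d a≢b′ b≢d′ a≢d′)
    ... | no i≢a | no i≢b | no i≢d = sym (cycle3-fixed a≢b′ b≢d′ a≢d′ (i≢a ∘ toℕ-injective)
      (i≢b ∘ toℕ-injective) (i≢d ∘ toℕ-injective))

·-assoc : ∀ {N} (x y z : Perm N) → (x · y) · z ≡ x · (y · z)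
·-assoc x y z = toFun-injective λ u → trans (toFun-· (x · y) z u) (trans (toFun-· x y _)
  (sym (trans (toFun-· x (y · z) u) (cong (toFun x) (toFun-· y z u)))))

·-identityˡ : ∀ {N} (x : Perm N) → ident · x ≡ x
·-identityˡ {N} x = toFun-injective λ u → trans (toFun-· ident x u) (toFun-ident N _)

·-identityʳ : ∀ {N} (x : Perm N) → x · ident ≡ x
·-identityʳ {N} x = toFun-injective λ u → trans (toFun-· x ident u) (cong (toFun x) (toFun-ident N u))

-- The reduction makes the values land in `Fin`; on functions that come from permutations it changes
-- nothing, by `fromFun-toFun`.
fromFun : ∀ {m} → (ℕ → ℕ) → Perm (suc m)
fromFun {m} f = tabulate (λ i → f (toℕ i) mod suc m)

fromFun-cong : ∀ {m} {f g : ℕ → ℕ} → (∀ u → f u ≡ g u) → fromFun {m} f ≡ fromFun g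
fromFun-cong h = tabulate-cong λ i → cong (_mod _) (h (toℕ i))

fromFun-toFun : ∀ {m} (x : Perm (suc m)) → fromFun (toFun x) ≡ x
fromFun-toFun {m} x = trans (tabulate-cong λ i → toℕ-injective (begin
    toℕ (toFun x (toℕ i) mod suc m)   ≡⟨ toℕ-fromℕ< _ ⟩
    toFun x (toℕ i) % suc m           ≡⟨ cong (_% suc m) (toFun-toℕ x i) ⟩
    toℕ (lookup x i) % suc m          ≡⟨ m<n⇒m%n≡m (toℕ<n (lookup x i)) ⟩
    toℕ (lookup x i)                  ∎)) (tabulate∘lookup x)
  where open ≡-Reasoning

IsProd3-ident : ∀ {N} → IsProd3 0 (ident {N})
IsProd3-ident = [] , refl , refl

IsProd3-· : ∀ {N a b} {x y : Perm N} → IsProd3 a x → IsProd3 b y → IsProd3 (a + b) (x · y)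
IsProd3-· {N} (K , refl , refl) (L , refl , refl) = K ++ L , length-++ K , fold K
  where
  ∏ : List (Triple N) → Perm N
  ∏ L = foldr _·_ ident (map threeCycle L)
  fold : ∀ K → ∏ (K ++ L) ≡ ∏ K · ∏ L
  fold []      = sym (·-identityˡ (∏ L))
  fold (t ∷ K) = trans (cong (threeCycle t ·_) (fold K)) (sym (·-assoc (threeCycle t) (∏ K) (∏ L)))

IsProd3⇒Prod3 : ∀ {N m} {x : Perm N} → IsProd3 m x → Prod3 N m (toFun x)
IsProd3⇒Prod3 {N} ([] , refl , refl) = nil (toFun-ident N)
IsProd3⇒Prod3 {N} (t@(triple a b d a≢b b≢d a≢d) ∷ L , refl , refl) =
  Prod3-cong (λ u → sym (toFun-· (threeCycle t) y u))
    (subst (λ k → Prod3 N k (toFun (threeCycle t) ∘ toFun y)) (+-comm (length L) 1)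
    (Prod3-∘ (snoc (toℕ<n a) (toℕ<n b) (toℕ<n d) (a≢b ∘ toℕ-injective) (b≢d ∘ toℕ-injective)
      (a≢d ∘ toℕ-injective)
       (nil λ _ → refl) (toFun-threeCycle t)) (IsProd3⇒Prod3 (L , refl , refl))))
  where y = foldr _·_ ident (map threeCycle L)

Prod3⇒IsProd3 : ∀ {N m f} → Prod3 N m f → ∃ λ (x : Perm N) → IsProd3 m x × (∀ u → toFun x u ≡ f u)
Prod3⇒IsProd3 {N} (nil h) = ident , IsProd3-ident , λ u → trans (toFun-ident N u) (sym (h u))
Prod3⇒IsProd3 {N} {suc m} {f} (snoc {g = g} {a} {b} {d} a< b< d< a≢b b≢d a≢d p h) with Prod3⇒IsProd3 p
... | x , x3 , x≗g = x · threeCycle t , subst (λ k → IsProd3 k (x · threeCycle t)) (+-comm m 1)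
  (IsProd3-· {x = x} {threeCycle t} x3 (t ∷ [] , refl , ·-identityʳ _)) ,
      λ u → trans (toFun-· x (threeCycle t) u) (trans (x≗g _)
        (trans (cong g (trans (toFun-threeCycle t u) (labels≡ u))) (sym (h u))))
  where
  ne : ∀ {u v} (u< : u < N) (v< : v < N) → u ≢ v → fromℕ< u< ≢ fromℕ< v<
  ne u< v< u≢v eq = u≢v (trans (sym (toℕ-fromℕ< u<)) (trans (cong toℕ eq) (toℕ-fromℕ< v<)))
  t : Triple N
  t = triple (fromℕ< a<) (fromℕ< b<) (fromℕ< d<) (ne a< b< a≢b) (ne b< d< b≢d) (ne a< d< a≢d)
  labels≡ : ∀ u → cycle3 (toℕ (fromℕ< a<)) (toℕ (fromℕ< b<)) (toℕ (fromℕ< d<)) u ≡ cycle3 a b d u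
  labels≡ u rewrite toℕ-fromℕ< a< | toℕ-fromℕ< b< | toℕ-fromℕ< d< = refl

Len3-unique : ∀ {N} {x : Perm N} {a b} → Len3 x a → Len3 x b → a ≡ b
Len3-unique (pa , mina) (pb , minb) = ≤-antisym (≮⇒≥ λ b<a → mina _ b<a pb) (≮⇒≥ λ a<b → minb _ a<b pa)

-- Multichains against factorizations

double-injective : InjectiveFun double
double-injective {zero}  {zero}  _  = refl
double-injective {suc x} {suc y} eq = cong suc (double-injective (suc-injective (suc-injective eq)))

1+double≢double : ∀ x y → suc (double x) ≢ double y
1+double≢double (suc x) (suc y) eq = 1+double≢double x y (suc-injective (suc-injective eq))

double-mono-< : ∀ {x y} → x < y → double x < double y
double-mono-< {zero}  {suc y} _       = z<s
double-mono-< {suc x} {suc y} (s≤s h) = s<s (s<s (double-mono-< h))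

-- The n even labels 0, 2, ..., 2n - 2 are sent to odd labels and so form an independent set.
IsLongCycle⇒≤ : ∀ {n m f} → IsLongCycle n f → IndepBound f m → n ≤ m
IsLongCycle⇒≤ {n} {m} {f} L bound = subst (_≤ m) (trans (length-map double (downFrom n)) (length-downFrom n))
  (bound (Unique.map⁺ double-injective (Unique.downFrom⁺ n)) indep)
  where
  indep : Independent f (map double (downFrom n))
  indep s∈ fs∈ with ∈-map⁻ double s∈ | ∈-map⁻ double fs∈
  ... | x , x∈ , refl | y , _ , eq = 1+double≢double x y
    (trans (sym (IsLongCycle.step L (double-mono-< (∈-downFrom⁻ x∈)))) eq)

IsLongCycle-unique : ∀ {n} {x y : Perm (suc (double n))} → IsLongCycle n (toFun x) → IsLongCycle n
  (toFun y) → x ≡ y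
IsLongCycle-unique {n} {x} {y} K L = toFun-injective agree
  where
  agree : ∀ u → toFun x u ≡ toFun y u
  agree u with <-cmp u (double n)
  ... | tri< u<2n _ _ = trans (IsLongCycle.step K u<2n) (sym (IsLongCycle.step L u<2n))
  ... | tri≈ _ refl _ = trans (IsLongCycle.wrap K) (sym (IsLongCycle.wrap L))
  ... | tri> _ _ 2n<u = trans (toFun-≥ x 2n<u) (sym (toFun-≥ y 2n<u))

IsLongCycle-cong : ∀ {n f g} → (∀ u → f u ≡ g u) → IsLongCycle n f → IsLongCycle n g
IsLongCycle-cong f≗g L = record
  { step = λ u<2n → trans (sym (f≗g _)) (IsLongCycle.step L u<2n) ; wrap = trans (sym (f≗g _))
    (IsLongCycle.wrap L) }

toFun-longCycle : ∀ n → IsLongCycle n (toFun (longCycle (double n)))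
toFun-longCycle n = record
  { step = λ {u} u<2n → trans (value (m<n⇒m<1+n u<2n)) (m<n⇒m%n≡m (s<s u<2n))
  ; wrap = trans (value ≤-refl) (n%n≡0 (suc (double n))) }
  where
  c = longCycle (double n)
  value : ∀ {u} → u < suc (double n) → toFun c u ≡ suc u % suc (double n)
  value {u} u<N = begin
    toFun c u                          ≡⟨ cong (toFun c) (toℕ-fromℕ< u<N) ⟨
    toFun c (toℕ i)                    ≡⟨ toFun-toℕ c i ⟩
    toℕ (lookup c i)                   ≡⟨ cong toℕ
      (lookup∘tabulate (λ i → suc (toℕ i) mod suc (double n)) i) ⟩
    toℕ (suc (toℕ i) mod suc (double n)) ≡⟨ toℕ-fromℕ< _ ⟩
    suc (toℕ i) % suc (double n)       ≡⟨ cong (λ v → suc v % suc (double n)) (toℕ-fromℕ< u<N) ⟩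
    suc u % suc (double n)             ∎
    where
    open ≡-Reasoning
    i = fromℕ< u<N

-- One colour and all insertions at position 0.
longCycle-prod3 : ∀ n → IsProd3 n (longCycle (double n))
longCycle-prod3 n with factor n
  where
  open Transfer 0
  factor : ∀ n → ∃ (Factorization3 n)
  factor zero    = _ , Factorization3-base
  factor (suc n) = _ , insert-pair {0} {0} z<s z<s (proj₂ (factor n))
... | w , F with Prod3⇒IsProd3 (prod3 z<s)
  where open Transfer.Factorization3 F
...   | x , x3 , x≗ = subst₂ IsProd3 (trans (sym (+-identityʳ _)) sum≡)
          (IsLongCycle-unique (IsLongCycle-cong (sym ∘ x≗) product) (toFun-longCycle n)) x3
  where open Transfer.Factorization3 F

longCycle-minimal : ∀ n {j} → IsProd3 j (longCycle (double n)) → n ≤ j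
longCycle-minimal n p = IsLongCycle⇒≤ (toFun-longCycle n) (Prod3⇒IndepBound (IsProd3⇒Prod3 p))

-- `∏ p` has p + 1 factors while `chain p` has p entries: q factors belong to q - 1 partial
-- products.
∏ : ∀ {N} → ℕ → (ℕ → Perm N) → Perm N
∏ zero    Z = Z 0
∏ (suc p) Z = Z 0 · ∏ p (Z ∘ suc)

chain : ∀ {N} p → Perm N → (ℕ → Perm N) → Vec (Perm N) p
chain zero    x Z = []
chain (suc p) x Z = (x · Z 0) ∷ chain p (x · Z 0) (Z ∘ suc)

chain-cong : ∀ {N} p {x : Perm N} {Y Z : ℕ → Perm N} → (∀ {j} → j < p → Y j ≡ Z j) → chain p x Y ≡ chain p x Z
chain-cong zero    h = refl
chain-cong (suc p) {x} {Y} {Z} h = trans (cong (λ y → (x · y) ∷ chain p (x · y) (Y ∘ suc)) (h z<s))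
  (cong ((x · Z 0) ∷_) (chain-cong p (h ∘ s<s)))

∏-prod3 : ∀ {N} p {Z : ℕ → Perm N} {m} → (∀ {j} → j < suc p → IsProd3 (m j) (Z j)) → IsProd3
  (sumTo (suc p) m) (∏ p Z)
∏-prod3 zero    {Z} {m} h = subst (λ k → IsProd3 k (Z 0)) (sym (+-identityʳ (m 0))) (h z<s)
∏-prod3 (suc p) {Z} {m} h = subst (λ k → IsProd3 k (∏ (suc p) Z)) (sym (sumTo-front (suc p) m))
  (IsProd3-· {x = Z 0} {∏ p (Z ∘ suc)} (h z<s) (∏-prod3 p (h ∘ s<s)))

toFun-∏ : ∀ {N} p (Z : ℕ → Perm N) u → toFun (∏ p Z) u ≡ comp (suc p) (toFun ∘ Z) u
toFun-∏ zero    Z u = refl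
toFun-∏ (suc p) Z u = trans (toFun-· (Z 0) (∏ p (Z ∘ suc)) u) (cong (toFun (Z 0)) (toFun-∏ p (Z ∘ suc) u))

·-cancelˡ : ∀ {N} (x : Perm N) {y z} → InjectiveFun (toFun x) → x · y ≡ x · z → y ≡ z
·-cancelˡ x {y} {z} inj eq = toFun-injective λ u →
  inj (trans (sym (toFun-· x y u)) (trans (cong (λ t → toFun t u) eq) (toFun-· x z u)))

-- The entries determine the factors one after another by cancelling the preceding partial product.
-- The last factor has no entry of its own and is determined by the total product.
chain-injective : ∀ {N} p (x : Perm N) {Y Z : ℕ → Perm N} → InjectiveFun (toFun x) →
  (∀ {j} → j < suc p → InjectiveFun (toFun (Y j))) →
  chain p x Y ≡ chain p x Z → x · ∏ p Y ≡ x · ∏ p Z → ∀ {j} → j < suc p → Y j ≡ Z j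
chain-injective zero x injx injY _ eq {zero} _ = ·-cancelˡ x injx eq
chain-injective zero x injx injY _ eq {suc j} (s≤s ())
chain-injective (suc p) x {Y} {Z} injx injY ceq eq {zero} _ = ·-cancelˡ x injx (Vec.∷-injectiveˡ ceq)
chain-injective (suc p) x {Y} {Z} injx injY ceq eq {suc j} (s≤s j<1+p) =
  chain-injective p (x · Y 0) inj′ (injY ∘ s<s) tails prods j<1+p
  where
  heads : x · Y 0 ≡ x · Z 0
  heads = Vec.∷-injectiveˡ ceq
  inj′ : InjectiveFun (toFun (x · Y 0))
  inj′ h = injY z<s (injx (trans (sym (toFun-· x (Y 0) _)) (trans h (toFun-· x (Y 0) _))))
  tails : chain p (x · Y 0) (Y ∘ suc) ≡ chain p (x · Y 0) (Z ∘ suc)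
  tails = trans (Vec.∷-injectiveʳ ceq) (cong (λ y → chain p y (Z ∘ suc)) (sym heads))
  prods : (x · Y 0) · ∏ p (Y ∘ suc) ≡ (x · Y 0) · ∏ p (Z ∘ suc)
  prods = trans (·-assoc x (Y 0) (∏ p (Y ∘ suc))) (trans eq
    (trans (sym (·-assoc x (Z 0) (∏ p (Z ∘ suc)))) (cong (_· ∏ p (Z ∘ suc)) (sym heads))))

module _ (n : ℕ) where
  private
    c : Perm (suc (double n))
    c = longCycle (double n)

  Len3-longCycle : Len3 c n
  Len3-longCycle = longCycle-prod3 n , λ j j<n p → <⇒≱ j<n (longCycle-minimal n p)

  -- A shorter product for `y` would give `c` as a product of fewer than n 3-cycles.
  Len3-factor : ∀ {l b r} {x y z} → IsProd3 l x → IsProd3 b y → IsProd3 r z →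
    x · (y · z) ≡ c → l + (b + r) ≡ n → Len3 y b
  Len3-factor {l} {b} {r} {x} {y} {z} px py pz eq sum = py , λ j j<b p →
    <⇒≱ (+-monoʳ-< l (+-monoˡ-< r j<b)) (subst (_≤ l + (j + r)) (sym sum)
      (longCycle-minimal n (subst (IsProd3 (l + (j + r))) eq
        (IsProd3-· {x = x} {y · z} px (IsProd3-· {x = y} {z} p pz)))))

  -- In a factorization of `c` into exactly n 3-cycles every consecutive block has minimal length,
  -- so lengths add. Padding with `ident` lets `Len3-factor` treat the initial blocks.
  ≤₃-intro : ∀ {a b d} {x y z} → IsProd3 a x → IsProd3 b y → IsProd3 d z →
    x · (y · z) ≡ c → a + (b + d) ≡ n → x ≤₃ (x · y)
  ≤₃-intro {a} {b} {d} {x} {y} {z} px py pz eq sum = y , refl , a , b , a + b ,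
    Len3-factor {x = ident} {x} {y · z} IsProd3-ident px (IsProd3-· {x = y} {z} py pz)
      (trans (·-identityˡ _) eq) sum ,
    Len3-factor {x = x} {y} {z} px py pz eq sum ,
    Len3-factor {x = ident} {x · y} {z} IsProd3-ident (IsProd3-· {x = x} {y} px py) pz
      (trans (·-identityˡ _) (trans (·-assoc x y z) eq)) (trans (+-assoc a b d) sum) , refl

  chain-sound : ∀ p {a m} (x : Perm (suc (double n))) (Z : ℕ → Perm (suc (double n))) → IsProd3 a x →
    (∀ {j} → j < suc p → IsProd3 (m j) (Z j)) →
    x · ∏ p Z ≡ c → a + sumTo (suc p) m ≡ n → AllIn ident c (chain p x Z) × Increasing (x ∷ chain p x Z)
  chain-sound zero x Z px pZ eq sum = tt , tt
  chain-sound (suc p) {a} {m} x Z px pZ eq sum =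
    let (all , inc) = chain-sound p y (Z ∘ suc) py (pZ ∘ s<s) y·R≡c sum′ in ((ident≤y , y≤c) , all) , (x≤y , inc)
    where
    y R : Perm (suc (double n))
    y = x · Z 0
    R = ∏ p (Z ∘ suc)
    py : IsProd3 (a + m 0) y
    py = IsProd3-· {x = x} {Z 0} px (pZ z<s)
    pR : IsProd3 (sumTo (suc p) (m ∘ suc)) R
    pR = ∏-prod3 p (pZ ∘ s<s)
    y·R≡c : y · R ≡ c
    y·R≡c = trans (·-assoc x (Z 0) R) eq
    sum″ : a + (m 0 + sumTo (suc p) (m ∘ suc)) ≡ n
    sum″ = trans (cong (a +_) (sym (sumTo-front (suc p) m))) sum
    sum′ : a + m 0 + sumTo (suc p) (m ∘ suc) ≡ n
    sum′ = trans (+-assoc a (m 0) _) sum″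
    x≤y : x ≤₃ y
    x≤y = ≤₃-intro {x = x} {Z 0} {R} px (pZ z<s) pR eq sum″
    ident≤y : ident ≤₃ y
    ident≤y = subst (ident ≤₃_) (·-identityˡ y)
      (≤₃-intro {x = ident} {y} {R} IsProd3-ident py pR (trans (·-identityˡ _) y·R≡c) sum′)
    y≤c : y ≤₃ c
    y≤c = subst (y ≤₃_) y·R≡c (≤₃-intro {x = y} {R} {ident} py pR IsProd3-ident
      (trans (cong (y ·_) (·-identityʳ R)) y·R≡c) (trans (cong (a + m 0 +_) (+-identityʳ _)) sum′))

  record Factors (p a : ℕ) (x : Perm (suc (double n))) (xs : Vec (Perm (suc (double n))) p) : Set where
    field
      Z     : ℕ → Perm (suc (double n))
      m     : ℕ → ℕ
      chain≡ : xs ≡ chain p x Z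
      prod≡ : x · ∏ p Z ≡ c
      prod3 : ∀ {j} → j < suc p → IsProd3 (m j) (Z j)
      sum≡  : a + sumTo (suc p) m ≡ n

  -- Each relation of the chain supplies the quotient of two neighbours and its length; the final
  -- relation, to `c`, supplies the last factor. By `Len3-unique` the lengths found on both sides of
  -- an entry agree, so the sum is n.
  chain-complete : ∀ p {a} x (xs : Vec (Perm (suc (double n))) p) → Len3 x a → x ≤₃ c →
    AllIn ident c xs → Increasing (x ∷ xs) → Factors p a x xs
  chain-complete zero {a} x [] Lx (z , xz≡c , a′ , b , l , Lx′ , Lz , Lc , l≡) _ _ = record
    { Z = λ _ → z ; m = λ _ → b ; chain≡ = refl ; prod≡ = xz≡c ; prod3 = λ _ → proj₁ Lz
    ; sum≡ = trans (cong₂ _+_ (Len3-unique Lx Lx′) (+-identityʳ b))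
      (trans (sym l≡) (Len3-unique Lc Len3-longCycle)) }
  chain-complete (suc p) {a} x (.(x · z) ∷ ys) Lx _ ((_ , y≤c) , all)
    ((z , refl , a′ , b , l , Lx′ , Lz , Ly , l≡) , inc) = record
    { Z = Z′ ; m = m′
    ; chain≡ = cong ((x · z) ∷_) chain≡
    ; prod≡ = trans (sym (·-assoc x z (∏ p Z))) prod≡
    ; prod3 = λ { {zero} _ → proj₁ Lz ; {suc j} (s≤s j<) → prod3 j< }
    ; sum≡ = trans (cong (a +_) (sumTo-front (suc p) m′)) (trans (sym (+-assoc a b (sumTo (suc p) m)))
        (trans (cong (_+ sumTo (suc p) m) (trans (cong (_+ b) (Len3-unique Lx Lx′)) (sym l≡))) sum≡)) }
    where
    open Factors (chain-complete p (x · z) ys Ly y≤c all inc)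
    Z′ : ℕ → Perm (suc (double n))
    Z′ zero    = z
    Z′ (suc j) = Z j
    m′ : ℕ → ℕ
    m′ zero    = b
    m′ (suc j) = m j

  Len3-ident : Len3 (ident {suc (double n)}) 0
  Len3-ident = IsProd3-ident , λ _ ()

  multichain⇒factors : ∀ p (xs : Vec (Perm (suc (double n))) p) → IsMultichain ident c xs →
    Factors p 0 ident xs
  multichain⇒factors p xs (all , inc) = chain-complete p ident xs Len3-ident ident≤c all (cons xs all inc)
    where
    ident≤c : ident ≤₃ c
    ident≤c = c , ·-identityˡ c , 0 , n , n , Len3-ident , Len3-longCycle , Len3-longCycle , refl
    cons : ∀ {p} (xs : Vec (Perm (suc (double n))) p) → AllIn ident c xs → Increasing xs → Increasing
      (ident ∷ xs)
    cons []       _               _   = tt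
    cons (x ∷ xs) ((id≤x , _) , _) inc = id≤x , inc

Increasing-tail : ∀ {N p} {x : Perm N} (xs : Vec (Perm N) p) → Increasing (x ∷ xs) → Increasing xs
Increasing-tail []       _         = tt
Increasing-tail (x ∷ xs) (_ , inc) = inc

Unique-map-∈ : ∀ {A B : Set} {f : A → B} {xs} → (∀ {x y} → x ∈ xs → y ∈ xs → f x ≡ f y → x ≡ y) →
  Unique xs → Unique (map f xs)
Unique-map-∈ inj []           = []
Unique-map-∈ inj (x∉xs ∷ uxs) =
  All.map⁺ (All.tabulate λ y∈ eq → All.lookup x∉xs y∈ (inj (here refl) (there y∈) eq)) ∷
  Unique-map-∈ (λ x∈ y∈ → inj (there x∈) (there y∈)) uxs

comp-cong : ∀ k {v w : ℕ → ℕ → ℕ} → (∀ {j} → j < k → ∀ u → v j u ≡ w j u) → ∀ u → comp k v u ≡ comp k w u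
comp-cong zero    h u = refl
comp-cong (suc k) {v} h u = trans (cong (v 0) (comp-cong k (h ∘ s<s) u)) (h z<s _)

-- The bijection between codes and multichains

module Enumeration (e n : ℕ) where
  open Positions e
  open Codes e
  open Flattening e
  open Transfer e
  open Flat using (at)

  N : ℕ
  N = suc (double n)

  -- Reads factor j back from the positions: division by q turns the image of j + u q into a label.
  factor : List ℕ → ℕ → Perm N
  factor code j = fromFun (λ u → decode code (j + u * q) / q)

  multichain : List ℕ → Vec (Perm N) e
  multichain code = chain e ident (factor code)

  flat⇒factor : ∀ {w} code → Flat w (decode code) → ∀ {j} (x : Perm N) → j < q →
    (∀ u → toFun x u ≡ w j u) → factor code j ≡ x
  flat⇒factor {w} code flat {j} x j<q x≗w = trans (fromFun-cong λ u → begin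
      decode code (j + u * q) / q   ≡⟨ cong (_/ q) (at flat j<q u) ⟩
      (j + w j u * q) / q           ≡⟨ [pos]/q (w j u) j<q ⟩
      w j u                         ≡⟨ x≗w u ⟨
      toFun x u                     ∎) (fromFun-toFun x)
    where open ≡-Reasoning

  record Decoded (code : List ℕ) : Set where
    field
      w     : ℕ → ℕ → ℕ
      flat  : Flat w (decode code)
      m     : ℕ → ℕ
      sum≡  : sumTo q m ≡ n
      prod3 : ∀ {j} → j < q → IsProd3 (m j) (factor code j)
      toFun-factor : ∀ {j} → j < q → ∀ u → toFun (factor code j) u ≡ w j u
      prod≡ : ∏ e (factor code) ≡ longCycle (double n)

  decoded : ∀ {code} → Valid n code → Decoded code
  decoded {code} valid with decode-sound valid
  ... | w , F , flat = record
    { w = w ; flat = flat ; m = m ; sum≡ = sum≡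
    ; prod3 = λ j<q → let (x , x3 , x≗w) = perm j<q in subst (IsProd3 _) (sym (flat⇒factor code flat x j<q x≗w)) x3
    ; toFun-factor = toFun-factor
    ; prod≡ = IsLongCycle-unique (IsLongCycle-cong
      (λ u → sym (trans (toFun-∏ e (factor code) u) (comp-cong q toFun-factor u))) product)
                (toFun-longCycle n) }
    where
    open Factorization3 F
    perm : ∀ {j} → j < q → ∃ λ (x : Perm N) → IsProd3 (m j) x × (∀ u → toFun x u ≡ w j u)
    perm j<q = Prod3⇒IsProd3 (prod3 j<q)
    toFun-factor : ∀ {j} → j < q → ∀ u → toFun (factor code j) u ≡ w j u
    toFun-factor j<q u = let (x , x3 , x≗w) = perm j<q in
      trans (cong (λ y → toFun y u) (flat⇒factor code flat x j<q x≗w)) (x≗w u)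

  multichain-sound : ∀ {code} → Valid n code → IsMultichain ident (longCycle (double n)) (multichain code)
  multichain-sound {code} valid =
    let (all , inc) = chain-sound n e ident (factor code) IsProd3-ident prod3 (trans (·-identityˡ _) prod≡) sum≡
    in all , Increasing-tail (multichain code) inc
    where open Decoded (decoded valid)

  -- A multichain determines its factors because their product is the long cycle; the factors
  -- determine the map of positions, and this determines the code.
  multichain-injective : ∀ {c d} → Valid n c → Valid n d → multichain c ≡ multichain d → c ≡ d
  multichain-injective {c} {d} vc vd eq = decode-injective vc vd same
    where
    module c = Decoded (decoded vc)
    module d = Decoded (decoded vd)
    factors≡ : ∀ {j} → j < q → factor c j ≡ factor d j
    factors≡ = chain-injective e ident (Prod3-injective (IsProd3⇒Prod3 {N} IsProd3-ident))
      (λ j<q → Prod3-injective (IsProd3⇒Prod3 (c.prod3 j<q))) eq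
        (cong (ident ·_) (trans c.prod≡ (sym d.prod≡)))
    w≡ : ∀ {j} → j < q → ∀ u → c.w j u ≡ d.w j u
    w≡ j<q u = trans (sym (c.toFun-factor j<q u)) (trans (cong (λ x → toFun x u) (factors≡ j<q))
      (d.toFun-factor j<q u))
    same : ∀ p → decode c p ≡ decode d p
    same p = subst (λ p → decode c p ≡ decode d p) (sym (pos p))
      (trans (at c.flat (m%n<n p q) (p / q)) (trans
        (cong (λ v → p % q + v * q) (w≡ (m%n<n p q) (p / q))) (sym (at d.flat (m%n<n p q) (p / q)))))

  multichain-surjective : ∀ xs → IsMultichain ident (longCycle (double n)) xs → ∃ λ code →
    Valid n code × xs ≡ multichain code
  multichain-surjective xs mc with decode-surjective n F
    where
    open Factors (multichain⇒factors n e xs mc)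
    F : Factorization e n (toFun ∘ Z)
    F = record
      { injective = λ j<q → Prod3-injective (IsProd3⇒Prod3 (prod3 j<q))
      ; fixes     = λ j<q → Prod3-fixed (IsProd3⇒Prod3 (prod3 j<q))
      ; product   = IsLongCycle-cong (λ u → trans (cong (λ x → toFun x u)
        (sym (trans (sym (·-identityˡ (∏ e Z))) prod≡))) (toFun-∏ e Z u)) (toFun-longCycle n)
      ; m         = m
      ; sum≤      = ≤-reflexive sum≡
      ; bound     = λ j<q → Prod3⇒IndepBound (IsProd3⇒Prod3 (prod3 j<q)) }
  ... | code , valid , flat = code , valid , trans chain≡ (chain-cong e λ j<e →
          sym (flat⇒factor code flat (Z _) (m<n⇒m<1+n j<e) (λ _ → refl)))
    where open Factors (multichain⇒factors n e xs mc)

  multichains : List (Vec (Perm N) e)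
  multichains = map multichain (codes n)

  multichains-unique : Unique multichains
  multichains-unique = Unique-map-∈ {f = multichain} {codes n}
    (λ {c} {d} c∈ d∈ → multichain-injective {c} {d} (codes⇒Valid n c∈) (codes⇒Valid n d∈)) (codes-unique n)

  ∈-multichains⁻ : ∀ xs → xs ∈ multichains → IsMultichain ident (longCycle (double n)) xs
  ∈-multichains⁻ xs xs∈ = let (code , code∈ , eq) = ∈-map⁻ multichain {xs = codes n} xs∈ in
    subst (IsMultichain ident (longCycle (double n))) (sym eq) (multichain-sound {code} (codes⇒Valid n code∈))

  ∈-multichains⁺ : ∀ xs → IsMultichain ident (longCycle (double n)) xs → xs ∈ multichains
  ∈-multichains⁺ xs mc = let (code , valid , eq) = multichain-surjective xs mc in
    subst (_∈ multichains) (sym eq) (∈-map⁺ multichain (Valid⇒codes valid))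

  enumeration : HasCount (IsMultichain ident (longCycle (double n))) (raney (e + q) n q)
  enumeration = multichains , multichains-unique , (λ xs → mk⇔ (∈-multichains⁻ xs) (∈-multichains⁺ xs)) ,
    trans (length-map multichain (codes n)) (length-codes n)

double≡2* : ∀ n → double n ≡ 2 * n
double≡2* zero    = refl
double≡2* (suc n) = trans (cong (2 +_) (double≡2* n)) (lem n)
  where
  lem : ∀ n → 2 + 2 * n ≡ 2 * suc n
  lem = solve-∀

theorem1p1 : (n : ℕ) → 1 ≤ n → (q : ℕ) → 1 ≤ q →
    Σ ℕ λ Z →
    HasCount (IsMultichain {suc (2 * n)} {q ∸ 1} ident (longCycle (2 * n))) Z
    × Z * (q * suc (2 * n) ∸ n) ≡ q * ((q * suc (2 * n) ∸ n) C n)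
theorem1p1 n _ (suc e) _ = raney (e + suc e) n (suc e) ,
  subst (λ M → HasCount (IsMultichain {suc M} {e} ident (longCycle M)) (raney (e + suc e) n (suc e)))
    (double≡2* n) (Enumeration.enumeration e n) ,
  subst₂ (λ p M → raney p n (suc e) * M ≡ suc e * (M C n)) (sym (+-suc e e)) M≡
    (raney-closed (e + e) n (suc e))
  where
  -- With p = 2q - 1 and r = q, the number p n + r in the closed form of `raney` is q (2n + 1) - n.
  M≡ : suc (e + e) * n + suc e ≡ suc e * suc (2 * n) ∸ n
  M≡ = sym (trans (cong (_∸ n) (lem e n)) (m+n∸m≡n n _))
    where
    lem : ∀ e n → suc e * suc (2 * n) ≡ n + (suc (e + e) * n + suc e)
    lem = solve-∀
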